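{- Let $p$ be a prime number, let $\widehat{\mathbb{F}_p(X)}$ be the completion of $\mathbb{F}_p(X)$ with respect to the $X$-adic valuation, and let $K$ be an equal characteristic local field, that is, a finite field extension of $\widehat{\mathbb{F}_p(X)}$. Assume that the extension $K/\widehat{\mathbb{F}_p(X)}$ is separable. Then $K$, endowed with the unique discrete valuation extending the $X$-adic valuation on $\widehat{\mathbb{F}_p(X)}$, is a local field.
   Context: $\mathbb{Z}_{\mathrm{m}0}$ is the linearly ordered commutative group with zero obtained from the multiplicatively written ordered group $\mathbb{Z}$ (elements $\mathrm{of\_add}(n)$, $n\in\mathbb{Z}$, with $\mathrm{of\_add}(a+b)=\mathrm{of\_add}(a)\,\mathrm{of\_add}(b)$, ordered as $\mathbb{Z}$) by adjoining an absorbing smallest element $0$. A valuation on a field $F$ is a function $v: F\to \mathbb{Z}_{\mathrm{m}0}$ with $v(0)=0$, $v(1)=1$, $v(xy)=v(x)v(y)$ and $v(x+y)\le\max\{v(x),v(y)\}$; it is discrete if it is surjective. Its unit ball is $F^\circ=\{x: v(x)\le1\}$, a discrete valuation ring when $v$ is discrete, and the residue field of $F$ is $F^\circ/\mathfrak{m}_{F^\circ}$ with $\mathfrak{m}_{F^\circ}$ the maximal ideal. A local field is a field complete with respect to a discrete valuation (for the uniform structure induced by the valuation) and with finite residue field. The $X$-adic valuation on $\mathbb{F}_p(X)$ sends $0$ to $0$ and $f/g$ (nonzero polynomials) to $\mathrm{of\_add}(-(a(f)-a(g)))$, where $a(f)$ is the exponent of $X$ in $f$; it extends by continuity to $\widehat{\mathbb{F}_p(X)}$,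 which is isomorphic to the field of Laurent series $\mathbb{F}_p(\!(X)\!)$. If $F$ is complete with respect to a discrete valuation $v$ and $K/F$ is finite, there is a unique discrete valuation $w$ on $K$ extending $v$, in the sense that $w|_F=v^e$ for some integer $e\ge1$. -}

module Defs where

open import Algebra.Bundles using (CommutativeRing; CommutativeSemigroup)
open import Algebra.Morphism.Structures using (module RingMorphisms)
open import Algebra.Structures using (IsAbelianGroup)
import Algebra.Properties.CommutativeMonoid.Sum
import Algebra.Properties.CommutativeSemigroup
import Algebra.Properties.Ring
import Algebra.Solver.Ring.NaturalCoefficients.Default
open import Data.Empty using (⊥-elim)
open import Data.Fin.Base using (Fin)
open import Data.Integer.Base as ℤ using (ℤ; +_)
import Data.Integer.Properties as ℤₚ
open import Data.Integer.Divisibility.Signed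
  using (_∣_; divides; _∣?_; ∣⇒∣ᵤ; ∣ᵤ⇒∣; ∣m∣n⇒∣m+n; ∣m⇒∣-m; ∣n⇒∣m*n)
open import Data.Integer.Solver using (module +-*-Solver)
open import Data.List.Base using (List; []; _∷_; map)
open import Data.Maybe.Base using (just)
open import Data.Maybe.Properties using (just-injective)
open import Data.Nat.Base as ℕ using (ℕ; zero; suc)
import Data.Nat.Divisibility as ℕ∣
open import Data.Nat.Primality using (Prime; euclidsLemma; ¬prime[1])
open import Data.Product.Base using (Σ; ∃; ∃-syntax; _×_; _,_; proj₁; proj₂)
open import Data.Sum.Base as Sum using (_⊎_; inj₁; inj₂)
open import Function.Bundles using (Inverse; _⇔_; mk⇔)
open import Function.Definitions using (Surjective)
open import Level using (0ℓ; _⊔_) renaming (suc to lsuc)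
open import Relation.Binary.PropositionalEquality.Core as ≡
  using (_≡_)
import Relation.Binary.PropositionalEquality.Properties as ≡ₚ
import Relation.Binary.Construct.Add.Infimum.NonStrict as NonStrict
import Relation.Binary.Construct.Add.Infimum.Strict as Strict
import Relation.Binary.Reasoning.Setoid as SetoidReasoning
open import Relation.Binary.Definitions using (tri<; tri≈; tri>)
open import Relation.Nullary.Construct.Add.Infimum using (_₋; ⊥₋; [_])
open import Relation.Nullary.Decidable.Core using (Dec; yes; no; map′)
open import Relation.Nullary.Negation.Core using (¬_; contradiction)
open import Relation.Unary using (Pred; _⊆_; _∩_; U; Satisfiable)

record Field c ℓ : Set (lsuc (c ⊔ ℓ)) where
  field
    commutativeRing : CommutativeRing c ℓ
  open CommutativeRing commutativeRing public
  field
    1≉0     : 1# ≉ 0#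
    inverse : ∀ x → x ≉ 0# → ∃[ y ] x * y ≈ 1#

record IntegralDomain c ℓ : Set (lsuc (c ⊔ ℓ)) where
  field
    commutativeRing : CommutativeRing c ℓ
  open CommutativeRing commutativeRing public
  field
    1≉0            : 1# ≉ 0#
    noZeroDivisors : ∀ x y → x * y ≈ 0# → x ≈ 0# ⊎ y ≈ 0#

record RingHom {c₁ ℓ₁ c₂ ℓ₂} (R : CommutativeRing c₁ ℓ₁) (S : CommutativeRing c₂ ℓ₂)
       : Set (c₁ ⊔ ℓ₁ ⊔ c₂ ⊔ ℓ₂) where
  private
    module R = CommutativeRing R
    module S = CommutativeRing S
  field
    ⟦_⟧                : R.Carrier → S.Carrier
    isRingHomomorphism : RingMorphisms.IsRingHomomorphism R.rawRing S.rawRing ⟦_⟧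
  open RingMorphisms.IsRingHomomorphism isRingHomomorphism public

-- A polynomial is the list of its coefficients, constant term first.
-- Trailing zeros are allowed, so equality is equality of all coefficients.

module Polynomial {c ℓ} (R : CommutativeRing c ℓ) where
  open CommutativeRing R
  open Algebra.Properties.Ring ring using (-0#≈0#)

  Poly : Set c
  Poly = List Carrier

  coeff : Poly → ℕ → Carrier
  coeff []      _       = 0#
  coeff (a ∷ f) zero    = a
  coeff (a ∷ f) (suc n) = coeff f n

  infix 4 _≈ₚ_
  record _≈ₚ_ (f g : Poly) : Set ℓ where
    constructor mk
    field at : ∀ n → coeff f n ≈ coeff g n
  open _≈ₚ_ public

  infixl 6 _+ₚ_
  _+ₚ_ : Poly → Poly → Poly
  []      +ₚ g       = g
  (a ∷ f) +ₚ []      = a ∷ f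
  (a ∷ f) +ₚ (b ∷ g) = a + b ∷ f +ₚ g

  -ₚ_ : Poly → Poly
  -ₚ f = map -_ f

  scale : Carrier → Poly → Poly
  scale a f = map (a *_) f

  shift : Poly → Poly
  shift f = 0# ∷ f

  infixl 7 _*ₚ_
  _*ₚ_ : Poly → Poly → Poly
  []      *ₚ g = []
  (a ∷ f) *ₚ g = scale a g +ₚ shift (f *ₚ g)

  1ₚ : Poly
  1ₚ = 1# ∷ []

  -- (a + X f)′ = f + X f′
  derivative : Poly → Poly
  derivative []      = []
  derivative (a ∷ f) = f +ₚ shift (derivative f)

  MonicOfDegree : ℕ → Poly → Set ℓ
  MonicOfDegree n f = coeff f n ≈ 1# × (∀ m → n ℕ.< m → coeff f m ≈ 0#)

  -- gcd(f , f′) = 1, in Bézout form.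
  SeparablePoly : Poly → Set (c ⊔ ℓ)
  SeparablePoly f = ∃[ a ] ∃[ b ] a *ₚ f +ₚ b *ₚ derivative f ≈ₚ 1ₚ

  ≈ₚ-refl : ∀ {f} → f ≈ₚ f
  ≈ₚ-refl .at n = refl

  ≈ₚ-sym : ∀ {f g} → f ≈ₚ g → g ≈ₚ f
  ≈ₚ-sym p .at n = sym (p .at n)

  ≈ₚ-trans : ∀ {f g h} → f ≈ₚ g → g ≈ₚ h → f ≈ₚ h
  ≈ₚ-trans p q .at n = trans (p .at n) (q .at n)

  coeff-+ : ∀ f g n → coeff (f +ₚ g) n ≈ coeff f n + coeff g n
  coeff-+ []      g       n       = sym (+-identityˡ _)
  coeff-+ (a ∷ f) []      n       = sym (+-identityʳ _)
  coeff-+ (a ∷ f) (b ∷ g) zero    = refl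
  coeff-+ (a ∷ f) (b ∷ g) (suc n) = coeff-+ f g n

  coeff-neg : ∀ f n → coeff (-ₚ f) n ≈ - coeff f n
  coeff-neg []      n       = sym -0#≈0#
  coeff-neg (a ∷ f) zero    = refl
  coeff-neg (a ∷ f) (suc n) = coeff-neg f n

  coeff-scale : ∀ a f n → coeff (scale a f) n ≈ a * coeff f n
  coeff-scale a []      n       = sym (zeroʳ a)
  coeff-scale a (b ∷ f) zero    = refl
  coeff-scale a (b ∷ f) (suc n) = coeff-scale a f n

  +ₚ-isAbelianGroup : IsAbelianGroup _≈ₚ_ _+ₚ_ [] -ₚ_
  +ₚ-isAbelianGroup = record
    { isGroup = record
      { isMonoid = record
        { isSemigroup = record
          { isMagma = record
            { isEquivalence = record { refl = ≈ₚ-refl ; sym = ≈ₚ-sym ; trans = ≈ₚ-trans }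
            ; ∙-cong = λ {f} {f′} {g} {g′} p q → mk λ n →
                trans (coeff-+ f g n)
                  (trans (+-cong (p .at n) (q .at n)) (sym (coeff-+ f′ g′ n)))
            }
          ; assoc = λ f g h → mk λ n →
              trans (coeff-+ (f +ₚ g) h n)
                (trans (+-congʳ (coeff-+ f g n))
                  (trans (+-assoc _ _ _)
                    (sym (trans (coeff-+ f (g +ₚ h) n) (+-congˡ (coeff-+ g h n))))))
          }
        ; identity = (λ f → ≈ₚ-refl)
                   , (λ f → mk λ n → trans (coeff-+ f [] n) (+-identityʳ _))
        }
      ; inverse = (λ f → mk λ n → trans (coeff-+ (-ₚ f) f n)
                    (trans (+-congʳ (coeff-neg f n)) (-‿inverseˡ _)))
                , (λ f → mk λ n → trans (coeff-+ f (-ₚ f) n)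
                    (trans (+-congˡ (coeff-neg f n)) (-‿inverseʳ _)))
      ; ⁻¹-cong = λ {f} {g} p → mk λ n →
          trans (coeff-neg f n) (trans (-‿cong (p .at n)) (sym (coeff-neg g n)))
      }
    ; comm = λ f g → mk λ n →
        trans (coeff-+ f g n) (trans (+-comm _ _) (sym (coeff-+ g f n)))
    }

  private
    module A = IsAbelianGroup +ₚ-isAbelianGroup
    +ₚ-commutativeSemigroup : CommutativeSemigroup c ℓ
    +ₚ-commutativeSemigroup = record { isCommutativeSemigroup = A.isCommutativeSemigroup }
    open Algebra.Properties.CommutativeSemigroup +ₚ-commutativeSemigroup
      using (interchange; x∙yz≈y∙xz)
    open SetoidReasoning A.setoid

  ∷-cong : ∀ {a b f g} → a ≈ b → f ≈ₚ g → a ∷ f ≈ₚ b ∷ g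
  ∷-cong p q .at zero    = p
  ∷-cong p q .at (suc n) = q .at n

  tail-cong : ∀ {a b f g} → a ∷ f ≈ₚ b ∷ g → f ≈ₚ g
  tail-cong p .at n = p .at (suc n)

  ∷≈[] : ∀ {a f} → a ≈ 0# → f ≈ₚ [] → a ∷ f ≈ₚ []
  ∷≈[] p q .at zero    = p
  ∷≈[] p q .at (suc n) = q .at n

  ∷≈[]⁻ : ∀ {a f} → a ∷ f ≈ₚ [] → f ≈ₚ []
  ∷≈[]⁻ p .at n = p .at (suc n)

  shift-+ : ∀ f g → shift (f +ₚ g) ≈ₚ shift f +ₚ shift g
  shift-+ f g = ∷-cong (sym (+-identityʳ 0#)) ≈ₚ-refl

  scale-cong : ∀ {a b f g} → a ≈ b → f ≈ₚ g → scale a f ≈ₚ scale b g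
  scale-cong {a} {b} {f} {g} p q .at n =
    trans (coeff-scale a f n) (trans (*-cong p (q .at n)) (sym (coeff-scale b g n)))

  scale-+ : ∀ a f g → scale a (f +ₚ g) ≈ₚ scale a f +ₚ scale a g
  scale-+ a f g .at n = trans (coeff-scale a (f +ₚ g) n)
    (trans (*-congˡ (coeff-+ f g n))
      (trans (distribˡ a _ _)
        (sym (trans (coeff-+ (scale a f) (scale a g) n)
          (+-cong (coeff-scale a f n) (coeff-scale a g n))))))

  +-scale : ∀ a b f → scale (a + b) f ≈ₚ scale a f +ₚ scale b f
  +-scale a b f .at n = trans (coeff-scale (a + b) f n)
    (trans (distribʳ _ a b)
      (sym (trans (coeff-+ (scale a f) (scale b f) n)
        (+-cong (coeff-scale a f n) (coeff-scale b f n)))))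

  scale-scale : ∀ a b f → scale (a * b) f ≈ₚ scale a (scale b f)
  scale-scale a b f .at n = trans (coeff-scale (a * b) f n)
    (trans (*-assoc _ _ _)
      (sym (trans (coeff-scale a (scale b f) n) (*-congˡ (coeff-scale b f n)))))

  0-scale : ∀ {a} → a ≈ 0# → ∀ f → scale a f ≈ₚ []
  0-scale {a} p f .at n = trans (coeff-scale a f n) (trans (*-congʳ p) (zeroˡ _))

  1-scale : ∀ f → scale 1# f ≈ₚ f
  1-scale f .at n = trans (coeff-scale 1# f n) (*-identityˡ _)

  ∷-*ₚ : ∀ {a} → a ≈ 0# → ∀ f g → (a ∷ f) *ₚ g ≈ₚ shift (f *ₚ g)
  ∷-*ₚ p f g = A.∙-congʳ (0-scale p g)

  *ₚ-zeroʳ : ∀ f → f *ₚ [] ≈ₚ []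
  *ₚ-zeroʳ []      = ≈ₚ-refl
  *ₚ-zeroʳ (a ∷ f) = ∷≈[] refl (*ₚ-zeroʳ f)

  *ₚ-∷ : ∀ f b g → f *ₚ (b ∷ g) ≈ₚ scale b f +ₚ shift (f *ₚ g)
  *ₚ-∷ []      b g = ≈ₚ-sym (∷≈[] refl ≈ₚ-refl)
  *ₚ-∷ (a ∷ f) b g = ∷-cong (+-congʳ (*-comm a b)) (begin
    scale a g +ₚ f *ₚ (b ∷ g)                ≈⟨ A.∙-congˡ (*ₚ-∷ f b g) ⟩
    scale a g +ₚ (scale b f +ₚ shift (f *ₚ g)) ≈⟨ x∙yz≈y∙xz (scale a g) (scale b f) _ ⟩
    scale b f +ₚ (scale a g +ₚ shift (f *ₚ g)) ∎)

  *ₚ-comm : ∀ f g → f *ₚ g ≈ₚ g *ₚ f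
  *ₚ-comm []      g = ≈ₚ-sym (*ₚ-zeroʳ g)
  *ₚ-comm (a ∷ f) g = begin
    scale a g +ₚ shift (f *ₚ g) ≈⟨ A.∙-congˡ (∷-cong refl (*ₚ-comm f g)) ⟩
    scale a g +ₚ shift (g *ₚ f) ≈⟨ *ₚ-∷ g a f ⟨
    g *ₚ (a ∷ f)                ∎

  *ₚ-congˡ : ∀ f {g h} → g ≈ₚ h → f *ₚ g ≈ₚ f *ₚ h
  *ₚ-congˡ []      p = ≈ₚ-refl
  *ₚ-congˡ (a ∷ f) p = A.∙-cong (scale-cong refl p) (∷-cong refl (*ₚ-congˡ f p))

  *ₚ-cong : ∀ {f f′ g g′} → f ≈ₚ f′ → g ≈ₚ g′ → f *ₚ g ≈ₚ f′ *ₚ g′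
  *ₚ-cong {f} {f′} {g} {g′} p q = begin
    f *ₚ g   ≈⟨ *ₚ-congˡ f q ⟩
    f *ₚ g′  ≈⟨ *ₚ-comm f g′ ⟩
    g′ *ₚ f  ≈⟨ *ₚ-congˡ g′ p ⟩
    g′ *ₚ f′ ≈⟨ *ₚ-comm g′ f′ ⟩
    f′ *ₚ g′ ∎

  *ₚ-distribʳ : ∀ h f g → (f +ₚ g) *ₚ h ≈ₚ f *ₚ h +ₚ g *ₚ h
  *ₚ-distribʳ h []      g       = ≈ₚ-refl
  *ₚ-distribʳ h (a ∷ f) []      = ≈ₚ-sym (A.identityʳ _)
  *ₚ-distribʳ h (a ∷ f) (b ∷ g) = begin
    scale (a + b) h +ₚ shift ((f +ₚ g) *ₚ h)
      ≈⟨ A.∙-cong (+-scale a b h)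
           (≈ₚ-trans (∷-cong refl (*ₚ-distribʳ h f g)) (shift-+ (f *ₚ h) (g *ₚ h))) ⟩
    (scale a h +ₚ scale b h) +ₚ (shift (f *ₚ h) +ₚ shift (g *ₚ h))
      ≈⟨ interchange (scale a h) (scale b h) _ _ ⟩
    (scale a h +ₚ shift (f *ₚ h)) +ₚ (scale b h +ₚ shift (g *ₚ h)) ∎

  scale-*ₚ : ∀ a f g → scale a f *ₚ g ≈ₚ scale a (f *ₚ g)
  scale-*ₚ a []      g = ≈ₚ-refl
  scale-*ₚ a (b ∷ f) g = begin
    scale (a * b) g +ₚ shift (scale a f *ₚ g)
      ≈⟨ A.∙-cong (scale-scale a b g) (∷-cong (sym (zeroʳ a)) (scale-*ₚ a f g)) ⟩
    scale a (scale b g) +ₚ scale a (shift (f *ₚ g))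
      ≈⟨ scale-+ a (scale b g) (shift (f *ₚ g)) ⟨
    scale a (scale b g +ₚ shift (f *ₚ g)) ∎

  *ₚ-assoc : ∀ f g h → (f *ₚ g) *ₚ h ≈ₚ f *ₚ (g *ₚ h)
  *ₚ-assoc []      g h = ≈ₚ-refl
  *ₚ-assoc (a ∷ f) g h = begin
    (scale a g +ₚ shift (f *ₚ g)) *ₚ h
      ≈⟨ *ₚ-distribʳ h (scale a g) (shift (f *ₚ g)) ⟩
    scale a g *ₚ h +ₚ shift (f *ₚ g) *ₚ h
      ≈⟨ A.∙-cong (scale-*ₚ a g h)
           (≈ₚ-trans (∷-*ₚ refl (f *ₚ g) h) (∷-cong refl (*ₚ-assoc f g h))) ⟩
    scale a (g *ₚ h) +ₚ shift (f *ₚ (g *ₚ h)) ∎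

  *ₚ-identityˡ : ∀ f → 1ₚ *ₚ f ≈ₚ f
  *ₚ-identityˡ f = ≈ₚ-trans (A.∙-cong (1-scale f) (∷≈[] refl ≈ₚ-refl)) (A.identityʳ f)

  polynomialRing : CommutativeRing c ℓ
  polynomialRing = record
    { Carrier = Poly
    ; _≈_ = _≈ₚ_
    ; _+_ = _+ₚ_
    ; _*_ = _*ₚ_
    ; -_  = -ₚ_
    ; 0#  = []
    ; 1#  = 1ₚ
    ; isCommutativeRing = record
      { isRing = record
        { +-isAbelianGroup = +ₚ-isAbelianGroup
        ; *-cong           = *ₚ-cong
        ; *-assoc          = *ₚ-assoc
        ; *-identity       = *ₚ-identityˡ
                           , (λ f → ≈ₚ-trans (*ₚ-comm f 1ₚ) (*ₚ-identityˡ f))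
        ; distrib          = (λ h f g → ≈ₚ-trans (*ₚ-comm h (f +ₚ g))
                               (≈ₚ-trans (*ₚ-distribʳ h f g)
                                 (A.∙-cong (*ₚ-comm f h) (*ₚ-comm g h))))
                           , *ₚ-distribʳ
        }
      ; *-comm = *ₚ-comm
      }
    }

module Fractions {c ℓ} (D : IntegralDomain c ℓ) where
  open IntegralDomain D
  open SetoidReasoning setoid
  open Algebra.Solver.Ring.NaturalCoefficients.Default commutativeSemiring
    using (solve; _:+_; _:*_; _:=_; con)
  open Algebra.Properties.Ring ring
    using (x∙y⁻¹≈ε⇒x≈y; x≈y⇒x∙y⁻¹≈ε; -‿distribˡ-*)

  record Fraction : Set (c ⊔ ℓ) where
    constructor _/_[_]
    field
      num   : Carrier
      den   : Carrier
      den≉0 : den ≉ 0#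
  open Fraction public

  *-≉0 : ∀ {x y} → x ≉ 0# → y ≉ 0# → x * y ≉ 0#
  *-≉0 x≉0 y≉0 xy≈0 = Sum.[ x≉0 , y≉0 ] (noZeroDivisors _ _ xy≈0)

  *-cancelʳ : ∀ {x y z} → z ≉ 0# → x * z ≈ y * z → x ≈ y
  *-cancelʳ {x} {y} {z} z≉0 eq
    with noZeroDivisors (x - y) z
           (trans (distribʳ z x (- y))
             (trans (+-congˡ (sym (-‿distribˡ-* y z))) (x≈y⇒x∙y⁻¹≈ε eq)))
  ... | inj₁ p = x∙y⁻¹≈ε⇒x≈y _ _ p
  ... | inj₂ p = contradiction p z≉0

  infix 4 _≈ᶠ_
  record _≈ᶠ_ (x y : Fraction) : Set ℓ where
    constructor mk
    field cross : num x * den y ≈ num y * den x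
  open _≈ᶠ_ public

  infixl 6 _+ᶠ_
  _+ᶠ_ : Fraction → Fraction → Fraction
  (a / b [ b≉0 ]) +ᶠ (c / d [ d≉0 ]) = (a * d + c * b) / (b * d) [ *-≉0 b≉0 d≉0 ]

  infixl 7 _*ᶠ_
  _*ᶠ_ : Fraction → Fraction → Fraction
  (a / b [ b≉0 ]) *ᶠ (c / d [ d≉0 ]) = (a * c) / (b * d) [ *-≉0 b≉0 d≉0 ]

  -ᶠ_ : Fraction → Fraction
  -ᶠ (a / b [ b≉0 ]) = (- a) / b [ b≉0 ]

  0ᶠ : Fraction
  0ᶠ = 0# / 1# [ 1≉0 ]

  1ᶠ : Fraction
  1ᶠ = 1# / 1# [ 1≉0 ]

  num≈0⇒≈0 : ∀ x → num x ≈ 0# → x ≈ᶠ 0ᶠ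
  num≈0⇒≈0 x p = mk (trans (*-congʳ p) (trans (zeroˡ _) (sym (zeroˡ _))))

  ≈0⇒num≈0 : ∀ x → x ≈ᶠ 0ᶠ → num x ≈ 0#
  ≈0⇒num≈0 x p = trans (sym (*-identityʳ _)) (trans (p .cross) (zeroˡ _))

  private
    ≈ᶠ-trans : ∀ {x y z} → x ≈ᶠ y → y ≈ᶠ z → x ≈ᶠ z
    ≈ᶠ-trans {a / b [ _ ]} {c / d [ d≉0 ]} {e / f [ _ ]} (mk p) (mk q) =
      mk (*-cancelʳ d≉0 (begin
        (a * f) * d ≈⟨ solve 3 (λ a f d → (a :* f) :* d := (a :* d) :* f) refl a f d ⟩
        (a * d) * f ≈⟨ *-congʳ p ⟩
        (c * b) * f ≈⟨ solve 3 (λ c b f → (c :* b) :* f := (c :* f) :* b) refl c b f ⟩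
        (c * f) * b ≈⟨ *-congʳ q ⟩
        (e * d) * b ≈⟨ solve 3 (λ e d b → (e :* d) :* b := (e :* b) :* d) refl e d b ⟩
        (e * b) * d ∎))

    +ᶠ-cong : ∀ {x x′ y y′} → x ≈ᶠ x′ → y ≈ᶠ y′ → x +ᶠ y ≈ᶠ x′ +ᶠ y′
    +ᶠ-cong {a / b [ _ ]} {a′ / b′ [ _ ]} {c / d [ _ ]} {c′ / d′ [ _ ]} (mk p) (mk q) =
      mk (begin
        (a * d + c * b) * (b′ * d′)
          ≈⟨ solve 6 (λ a b c d b′ d′ → (a :* d :+ c :* b) :* (b′ :* d′) :=
               (a :* b′) :* (d :* d′) :+ (c :* d′) :* (b :* b′)) refl a b c d b′ d′ ⟩
        (a * b′) * (d * d′) + (c * d′) * (b * b′)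
          ≈⟨ +-cong (*-congʳ p) (*-congʳ q) ⟩
        (a′ * b) * (d * d′) + (c′ * d) * (b * b′)
          ≈⟨ solve 6 (λ a′ b c′ d b′ d′ →
               (a′ :* b) :* (d :* d′) :+ (c′ :* d) :* (b :* b′) :=
               (a′ :* d′ :+ c′ :* b′) :* (b :* d)) refl a′ b c′ d b′ d′ ⟩
        (a′ * d′ + c′ * b′) * (b * d) ∎)

    *ᶠ-cong : ∀ {x x′ y y′} → x ≈ᶠ x′ → y ≈ᶠ y′ → x *ᶠ y ≈ᶠ x′ *ᶠ y′
    *ᶠ-cong {a / b [ _ ]} {a′ / b′ [ _ ]} {c / d [ _ ]} {c′ / d′ [ _ ]} (mk p) (mk q) =
      mk (begin
        (a * c) * (b′ * d′)
          ≈⟨ solve 4 (λ a c b′ d′ → (a :* c) :* (b′ :* d′) := (a :* b′) :* (c :* d′))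
               refl a c b′ d′ ⟩
        (a * b′) * (c * d′) ≈⟨ *-cong p q ⟩
        (a′ * b) * (c′ * d)
          ≈⟨ solve 4 (λ a b c d → (a :* b) :* (c :* d) := (a :* c) :* (b :* d))
               refl a′ b c′ d ⟩
        (a′ * c′) * (b * d) ∎)

    -ᶠ-cong : ∀ {x y} → x ≈ᶠ y → -ᶠ x ≈ᶠ -ᶠ y
    -ᶠ-cong (mk p) =
      mk (trans (sym (-‿distribˡ-* _ _)) (trans (-‿cong p) (-‿distribˡ-* _ _)))

    +ᶠ-comm : ∀ x y → x +ᶠ y ≈ᶠ y +ᶠ x
    +ᶠ-comm (a / b [ _ ]) (c / d [ _ ]) = mk (*-cong (+-comm _ _) (*-comm _ _))

    *ᶠ-comm : ∀ x y → x *ᶠ y ≈ᶠ y *ᶠ x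
    *ᶠ-comm (a / b [ _ ]) (c / d [ _ ]) = mk (*-cong (*-comm _ _) (*-comm _ _))

    +ᶠ-assoc : ∀ x y z → (x +ᶠ y) +ᶠ z ≈ᶠ x +ᶠ (y +ᶠ z)
    +ᶠ-assoc (a / b [ _ ]) (c / d [ _ ]) (e / f [ _ ]) =
      mk (solve 6 (λ a b c d e f →
        ((a :* d :+ c :* b) :* f :+ e :* (b :* d)) :* (b :* (d :* f)) :=
        (a :* (d :* f) :+ (c :* f :+ e :* d) :* b) :* ((b :* d) :* f)) refl a b c d e f)

    *ᶠ-assoc : ∀ x y z → (x *ᶠ y) *ᶠ z ≈ᶠ x *ᶠ (y *ᶠ z)
    *ᶠ-assoc _ _ _ = mk (*-cong (*-assoc _ _ _) (sym (*-assoc _ _ _)))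

    +ᶠ-identityˡ : ∀ x → 0ᶠ +ᶠ x ≈ᶠ x
    +ᶠ-identityˡ (a / b [ _ ]) =
      mk (solve 2 (λ a b → (con 0 :* b :+ a :* con 1) :* b := a :* (con 1 :* b)) refl a b)

    *ᶠ-identityˡ : ∀ x → 1ᶠ *ᶠ x ≈ᶠ x
    *ᶠ-identityˡ (a / b [ _ ]) =
      mk (solve 2 (λ a b → (con 1 :* a) :* b := a :* (con 1 :* b)) refl a b)

    -ᶠ-inverseˡ : ∀ x → (-ᶠ x) +ᶠ x ≈ᶠ 0ᶠ
    -ᶠ-inverseˡ x@(a / b [ _ ]) = num≈0⇒≈0 ((-ᶠ x) +ᶠ x)
      (trans (sym (distribʳ b (- a) a)) (trans (*-congʳ (-‿inverseˡ a)) (zeroˡ b)))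

    *ᶠ-distribˡ : ∀ x y z → x *ᶠ (y +ᶠ z) ≈ᶠ x *ᶠ y +ᶠ x *ᶠ z
    *ᶠ-distribˡ (a / b [ _ ]) (c / d [ _ ]) (e / f [ _ ]) =
      mk (solve 6 (λ a b c d e f →
        (a :* (c :* f :+ e :* d)) :* ((b :* d) :* (b :* f)) :=
        ((a :* c) :* (b :* f) :+ (a :* e) :* (b :* d)) :* (b :* (d :* f)))
        refl a b c d e f)

  fractionRing : CommutativeRing (c ⊔ ℓ) ℓ
  fractionRing = record
    { Carrier = Fraction
    ; _≈_ = _≈ᶠ_
    ; _+_ = _+ᶠ_
    ; _*_ = _*ᶠ_
    ; -_  = -ᶠ_
    ; 0#  = 0ᶠ
    ; 1#  = 1ᶠ
    ; isCommutativeRing = record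
      { isRing = record
        { +-isAbelianGroup = record
          { isGroup = record
            { isMonoid = record
              { isSemigroup = record
                { isMagma = record
                  { isEquivalence = record
                    { refl  = mk refl
                    ; sym   = λ p → mk (sym (p .cross))
                    ; trans = ≈ᶠ-trans
                    }
                  ; ∙-cong = +ᶠ-cong
                  }
                ; assoc = +ᶠ-assoc
                }
              ; identity = +ᶠ-identityˡ
                         , (λ x → ≈ᶠ-trans (+ᶠ-comm x 0ᶠ) (+ᶠ-identityˡ x))
              }
            ; inverse = -ᶠ-inverseˡ
                      , (λ x → ≈ᶠ-trans (+ᶠ-comm x (-ᶠ x)) (-ᶠ-inverseˡ x))
            ; ⁻¹-cong = -ᶠ-cong
            }
          ; comm = +ᶠ-comm
          }
        ; *-cong     = *ᶠ-cong
        ; *-assoc    = *ᶠ-assoc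
        ; *-identity = *ᶠ-identityˡ
                     , (λ x → ≈ᶠ-trans (*ᶠ-comm x 1ᶠ) (*ᶠ-identityˡ x))
        ; distrib    = *ᶠ-distribˡ
                     , (λ x y z → ≈ᶠ-trans (*ᶠ-comm (y +ᶠ z) x)
                         (≈ᶠ-trans (*ᶠ-distribˡ x y z)
                           (+ᶠ-cong (*ᶠ-comm x y) (*ᶠ-comm x z))))
        }
      ; *-comm = *ᶠ-comm
      }
    }

  fractionField : Field (c ⊔ ℓ) ℓ
  fractionField = record
    { commutativeRing = fractionRing
    ; 1≉0     = λ p → 1≉0 (≈0⇒num≈0 1ᶠ p)
    ; inverse = λ x x≉0 → den x / num x [ (λ p → x≉0 (num≈0⇒≈0 x p)) ]
        , mk (trans (*-congʳ (*-comm _ _))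
               (trans (*-identityʳ _) (sym (*-identityˡ _))))
    }

ℤₘ₀ : Set
ℤₘ₀ = ℤ ₋

-- The group ℤ is written multiplicatively; ⊥₋ is the adjoined zero.
pattern 𝟘 = ⊥₋
pattern ofAdd n = [ n ]

𝟙 : ℤₘ₀
𝟙 = ofAdd (+ 0)

open NonStrict ℤ._≤_ public using (_≤₋_; [_]; ⊥₋≤_)
open Strict ℤ._<_ public using (_<₋_; [_]; ⊥₋<[_])

infixl 7 _·_
_·_ : ℤₘ₀ → ℤₘ₀ → ℤₘ₀
𝟘       · δ       = 𝟘
ofAdd m · 𝟘       = 𝟘
ofAdd m · ofAdd n = ofAdd (m ℤ.+ n)

infixr 8 _^_
_^_ : ℤₘ₀ → ℕ → ℤₘ₀
γ ^ zero  = 𝟙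
γ ^ suc n = γ · γ ^ n

max : ℤₘ₀ → ℤₘ₀ → ℤₘ₀
max 𝟘         δ         = δ
max (ofAdd m) 𝟘         = ofAdd m
max (ofAdd m) (ofAdd n) = ofAdd (m ℤ.⊔ n)

·-zeroʳ : ∀ γ → γ · 𝟘 ≡ 𝟘
·-zeroʳ 𝟘         = ≡.refl
·-zeroʳ (ofAdd m) = ≡.refl

·-identityˡ : ∀ γ → 𝟙 · γ ≡ γ
·-identityˡ 𝟘         = ≡.refl
·-identityˡ (ofAdd m) = ≡.cong just (ℤₚ.+-identityˡ m)

·-comm : ∀ γ δ → γ · δ ≡ δ · γ
·-comm 𝟘         δ         = ≡.sym (·-zeroʳ δ)
·-comm (ofAdd m) 𝟘         = ≡.refl
·-comm (ofAdd m) (ofAdd n) = ≡.cong just (ℤₚ.+-comm m n)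

·-assoc : ∀ γ δ ε → (γ · δ) · ε ≡ γ · (δ · ε)
·-assoc 𝟘         δ         ε         = ≡.refl
·-assoc (ofAdd l) 𝟘         ε         = ≡.refl
·-assoc (ofAdd l) (ofAdd m) 𝟘         = ≡.refl
·-assoc (ofAdd l) (ofAdd m) (ofAdd n) = ≡.cong just (ℤₚ.+-assoc l m n)

·-integral : ∀ γ δ → γ · δ ≡ 𝟘 → γ ≡ 𝟘 ⊎ δ ≡ 𝟘
·-integral 𝟘         δ eq = inj₁ ≡.refl
·-integral (ofAdd m) 𝟘 eq = inj₂ ≡.refl

·-interchange : ∀ α β γ δ → (α · β) · (γ · δ) ≡ (α · γ) · (β · δ)
·-interchange α β γ δ = begin
  (α · β) · (γ · δ) ≡⟨ ·-assoc α β (γ · δ) ⟩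
  α · (β · (γ · δ)) ≡⟨ ≡.cong (α ·_) (·-assoc β γ δ) ⟨
  α · ((β · γ) · δ) ≡⟨ ≡.cong (λ ε → α · (ε · δ)) (·-comm β γ) ⟩
  α · ((γ · β) · δ) ≡⟨ ≡.cong (α ·_) (·-assoc γ β δ) ⟩
  α · (γ · (β · δ)) ≡⟨ ·-assoc α γ (β · δ) ⟨
  (α · γ) · (β · δ) ∎
  where open ≡ₚ.≡-Reasoning

private
  +-neg : ∀ m n → m ℤ.+ n ℤ.+ ℤ.- n ≡ m
  +-neg m n = ≡.trans (ℤₚ.+-assoc m n (ℤ.- n))
    (≡.trans (≡.cong (λ k → m ℤ.+ k) (ℤₚ.+-inverseʳ n)) (ℤₚ.+-identityʳ m))

·-cancelʳ : ∀ {γ δ} n → γ · ofAdd n ≡ δ · ofAdd n → γ ≡ δ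
·-cancelʳ {𝟘}       {𝟘}       n eq = ≡.refl
·-cancelʳ {ofAdd l} {ofAdd m} n eq = ≡.cong just
  (≡.trans (≡.sym (+-neg l n))
    (≡.trans (≡.cong (λ k → k ℤ.+ ℤ.- n) (just-injective eq)) (+-neg m n)))

·-cancelʳ-≤ : ∀ {γ δ} n → γ · ofAdd n ≤₋ δ · ofAdd n → γ ≤₋ δ
·-cancelʳ-≤ {𝟘}       {δ}       n le     = ⊥₋≤ δ
·-cancelʳ-≤ {ofAdd l} {ofAdd m} n [ le ] =
  [ ≡.subst₂ ℤ._≤_ (+-neg l n) (+-neg m n) (ℤₚ.+-monoˡ-≤ (ℤ.- n) le) ]

·-square : ∀ γ → γ · γ ≡ 𝟙 → γ ≡ 𝟙
·-square (ofAdd n) eq with ℤₚ.<-cmp n (+ 0)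
... | tri≈ _ n≡0 _ = ≡.cong just n≡0
... | tri< n<0 _ _ =
      ⊥-elim (ℤₚ.<⇒≢ (ℤₚ.+-mono-< n<0 n<0) (just-injective eq))
... | tri> _ _ n>0 =
      ⊥-elim (ℤₚ.<⇒≢ (ℤₚ.+-mono-< n>0 n>0) (≡.sym (just-injective eq)))

·-monoʳ-≤ : ∀ γ {δ ε} → δ ≤₋ ε → γ · δ ≤₋ γ · ε
·-monoʳ-≤ 𝟘         le         = ⊥₋≤ 𝟘
·-monoʳ-≤ (ofAdd m) (⊥₋≤ ε)    = ⊥₋≤ (ofAdd m · ε)
·-monoʳ-≤ (ofAdd m) ([ le ])   = [ ℤₚ.+-monoʳ-≤ m le ]

·-≤𝟙 : ∀ {γ δ} → γ ≤₋ 𝟙 → δ ≤₋ 𝟙 → γ · δ ≤₋ 𝟙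
·-≤𝟙 (⊥₋≤ _) q        = ⊥₋≤ 𝟙
·-≤𝟙 [ p ]   (⊥₋≤ _)  = ⊥₋≤ 𝟙
·-≤𝟙 [ p ]   [ q ]    = [ ℤₚ.+-mono-≤ p q ]

·-<𝟙 : ∀ {γ δ} → γ ≤₋ 𝟙 → δ <₋ 𝟙 → γ · δ <₋ 𝟙
·-<𝟙 (⊥₋≤ _) q         = ⊥₋<[ + 0 ]
·-<𝟙 [ p ]   ⊥₋<[ _ ]  = ⊥₋<[ + 0 ]
·-<𝟙 [ p ]   [ q ]     = [ ℤₚ.+-mono-≤-< p q ]

≤₋-refl : ∀ {γ} → γ ≤₋ γ
≤₋-refl {𝟘}       = ⊥₋≤ 𝟘
≤₋-refl {ofAdd n} = [ ℤₚ.≤-refl ]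

≤₋-trans : ∀ {γ δ ε} → γ ≤₋ δ → δ ≤₋ ε → γ ≤₋ ε
≤₋-trans = NonStrict.≤₋-trans ℤ._≤_ ℤₚ.≤-trans

≤-<₋-trans : ∀ {γ δ ε} → γ ≤₋ δ → δ <₋ ε → γ <₋ ε
≤-<₋-trans (⊥₋≤ _) ⊥₋<[ n ] = ⊥₋<[ n ]
≤-<₋-trans (⊥₋≤ _) [ _ ]    = ⊥₋<[ _ ]
≤-<₋-trans [ p ]   [ q ]    = [ ℤₚ.≤-<-trans p q ]

max-lub : ∀ {γ δ ε} → γ ≤₋ ε → δ ≤₋ ε → max γ δ ≤₋ ε
max-lub (⊥₋≤ _) q         = q
max-lub [ p ]   (⊥₋≤ _)   = [ p ]
max-lub [ p ]   [ q ]     = [ ℤₚ.⊔-lub p q ]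

max-lub-< : ∀ {γ δ ε} → γ <₋ ε → δ <₋ ε → max γ δ <₋ ε
max-lub-< ⊥₋<[ _ ] q        = q
max-lub-< [ p ]    ⊥₋<[ _ ] = [ p ]
max-lub-< {ofAdd l} {ofAdd m} [ p ] [ q ] with ℤₚ.⊔-sel l m
... | inj₁ eq = [ ≡.subst (λ k → k ℤ.< _) (≡.sym eq) p ]
... | inj₂ eq = [ ≡.subst (λ k → k ℤ.< _) (≡.sym eq) q ]

≤-maxˡ : ∀ γ δ → γ ≤₋ max γ δ
≤-maxˡ 𝟘         δ         = ⊥₋≤ δ
≤-maxˡ (ofAdd m) 𝟘         = ≤₋-refl
≤-maxˡ (ofAdd m) (ofAdd n) = [ ℤₚ.i≤i⊔j m n ]

≤-maxʳ : ∀ γ δ → δ ≤₋ max γ δ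
≤-maxʳ 𝟘         δ         = ≤₋-refl
≤-maxʳ (ofAdd m) 𝟘         = ⊥₋≤ _
≤-maxʳ (ofAdd m) (ofAdd n) = [ ℤₚ.i≤j⊔i m n ]

·-distribˡ-max : ∀ ε γ δ → ε · max γ δ ≡ max (ε · γ) (ε · δ)
·-distribˡ-max 𝟘         γ         δ         = ≡.refl
·-distribˡ-max (ofAdd l) 𝟘         δ         = ≡.refl
·-distribˡ-max (ofAdd l) (ofAdd m) 𝟘         = ≡.refl
·-distribˡ-max (ofAdd l) (ofAdd m) (ofAdd n) =
  ≡.cong just (ℤₚ.mono-≤-distrib-⊔ {f = λ k → l ℤ.+ k} (ℤₚ.+-monoʳ-≤ l) m n)

·-identityʳ : ∀ γ → γ · 𝟙 ≡ γ
·-identityʳ γ = ≡.trans (·-comm γ 𝟙) (·-identityˡ γ)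

record Valuation {c ℓ} (F : Field c ℓ) : Set (c ⊔ ℓ) where
  open Field F
  field
    val         : Carrier → ℤₘ₀
    val-cong    : ∀ {x y} → x ≈ y → val x ≡ val y
    val-0       : val 0# ≡ 𝟘
    val-1       : val 1# ≡ 𝟙
    val-*       : ∀ x y → val (x * y) ≡ val x · val y
    ultrametric : ∀ x y → val (x + y) ≤₋ max (val x) (val y)

-- Filters on A.  Subsets and the collection of members are taken in the
-- lowest universe; under excluded middle every predicate is equivalent
-- to one of these.

record Filter {a} (A : Set a) : Set (a ⊔ lsuc 0ℓ) where
  field
    member   : Pred (Pred A 0ℓ) 0ℓ
    universe : member U
    upward   : ∀ {P Q} → P ⊆ Q → member P → member Q
    ∩-closed : ∀ {P Q} → member P → member Q → member (P ∩ Q)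
    proper   : ∀ {P} → member P → Satisfiable P

module _ {c ℓ} {F : Field c ℓ} (v : Valuation F) where
  open Field F
  open Valuation v
  open Algebra.Properties.Ring ring
    using (-‿distribʳ-*; -‿involutive; -1*x≈-x; -‿+-comm)

  Discrete : Set (c ⊔ ℓ)
  Discrete = Surjective _≈_ _≡_ val

  -- The uniformity has the entourages {(x , y) ∣ v (x - y) < γ}, for γ ≠ 0.

  Cauchy : Filter Carrier → Set (c ⊔ lsuc 0ℓ)
  Cauchy 𝓕 = ∀ (n : ℤ) → ∃[ P ] Filter.member 𝓕 P ×
    (∀ {x y} → P x → P y → val (x - y) <₋ ofAdd n)

  ConvergesTo : Filter Carrier → Carrier → Set
  ConvergesTo 𝓕 x = ∀ (n : ℤ) → Filter.member 𝓕 (λ y → val (y - x) <₋ ofAdd n)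

  Complete : Set (c ⊔ lsuc 0ℓ)
  Complete = ∀ (𝓕 : Filter Carrier) → Cauchy 𝓕 → ∃[ x ] ConvergesTo 𝓕 x

  val-neg : ∀ x → val (- x) ≡ val x
  val-neg x = begin
    val (- x)           ≡⟨ val-cong (-1*x≈-x x) ⟨
    val (- 1# * x)      ≡⟨ val-* (- 1#) x ⟩
    val (- 1#) · val x  ≡⟨ ≡.cong (_· val x) (·-square (val (- 1#)) val[-1]²) ⟩
    𝟙 · val x           ≡⟨ ·-identityˡ (val x) ⟩
    val x               ∎
    where
    open ≡ₚ.≡-Reasoning
    val[-1]² : val (- 1#) · val (- 1#) ≡ 𝟙
    val[-1]² = ≡.trans (≡.sym (val-* (- 1#) (- 1#)))
      (≡.trans (val-cong (trans (-1*x≈-x (- 1#)) (-‿involutive 1#))) val-1)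

  record UnitBall : Set c where
    constructor _,_
    field
      elem  : Carrier
      elem≤ : val elem ≤₋ 𝟙
  open UnitBall public

  private
    𝒪 = UnitBall

    _+ₒ_ _*ₒ_ : 𝒪 → 𝒪 → 𝒪
    (x , p) +ₒ (y , q) = x + y , ≤₋-trans (ultrametric x y) (max-lub p q)
    (x , p) *ₒ (y , q) = x * y , ≡.subst (_≤₋ 𝟙) (≡.sym (val-* x y)) (·-≤𝟙 p q)

    -ₒ_ : 𝒪 → 𝒪
    -ₒ (x , p) = - x , ≡.subst (_≤₋ 𝟙) (≡.sym (val-neg x)) p

    0ₒ 1ₒ : 𝒪
    0ₒ = 0# , ≡.subst (_≤₋ 𝟙) (≡.sym val-0) (⊥₋≤ 𝟙)
    1ₒ = 1# , ≡.subst (_≤₋ 𝟙) (≡.sym val-1) ≤₋-refl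

  unitBall : CommutativeRing c ℓ
  unitBall = record
    { Carrier = UnitBall
    ; _≈_ = λ x y → elem x ≈ elem y
    ; _+_ = _+ₒ_
    ; _*_ = _*ₒ_
    ; -_  = -ₒ_
    ; 0#  = 0ₒ
    ; 1#  = 1ₒ
    ; isCommutativeRing = record
      { isRing = record
        { +-isAbelianGroup = record
          { isGroup = record
            { isMonoid = record
              { isSemigroup = record
                { isMagma = record
                  { isEquivalence = record { refl = refl ; sym = sym ; trans = trans }
                  ; ∙-cong = +-cong
                  }
                ; assoc = λ _ _ _ → +-assoc _ _ _
                }
              ; identity = (λ _ → +-identityˡ _) , (λ _ → +-identityʳ _)
              }
            ; inverse = (λ _ → -‿inverseˡ _) , (λ _ → -‿inverseʳ _)
            ; ⁻¹-cong = -‿cong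
            }
          ; comm = λ _ _ → +-comm _ _
          }
        ; *-cong     = *-cong
        ; *-assoc    = λ _ _ _ → *-assoc _ _ _
        ; *-identity = (λ _ → *-identityˡ _) , (λ _ → *-identityʳ _)
        ; distrib    = (λ _ _ _ → distribˡ _ _ _) , (λ _ _ _ → distribʳ _ _ _)
        }
      ; *-comm = λ _ _ → *-comm _ _
      }
    }

  -- See 𝔪⇔nonUnit: these are the non-units, so 𝔪 is the maximal ideal.
  𝔪 : Pred UnitBall 0ℓ
  𝔪 x = val (elem x) <₋ 𝟙

  𝔪⇔nonUnit : ∀ x → 𝔪 x ⇔ (¬ (∃[ y ] elem x * elem y ≈ 1#))
  𝔪⇔nonUnit (x , x≤1) = mk⇔ to from
    where
    to : val x <₋ 𝟙 → ¬ (∃[ y ] x * elem y ≈ 1#)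
    to x<1 ((y , y≤1) , xy≈1) = irrefl
      (≡.subst (_<₋ 𝟙)
        (≡.trans (·-comm (val y) (val x))
          (≡.trans (≡.sym (val-* x y)) (≡.trans (val-cong xy≈1) val-1)))
        (·-<𝟙 y≤1 x<1))
      where
      irrefl : ¬ (𝟙 <₋ 𝟙)
      irrefl [ p ] = ℤₚ.<-irrefl ≡.refl p

    unit : val x ≡ 𝟙 → ∃[ y ] x * elem y ≈ 1#
    unit eq = (y , ≡.subst (_≤₋ 𝟙) (≡.sym val-y) ≤₋-refl) , xy≈1
      where
      x≉0 : x ≉ 0#
      x≉0 x≈0 with ≡.trans (≡.sym eq) (≡.trans (val-cong x≈0) val-0)
      ... | ()
      y = proj₁ (inverse x x≉0)
      xy≈1 = proj₂ (inverse x x≉0)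
      val-y : val y ≡ 𝟙
      val-y = ≡.trans (≡.sym (·-identityˡ (val y)))
        (≡.trans (≡.cong (_· val y) (≡.sym eq))
          (≡.trans (≡.sym (val-* x y)) (≡.trans (val-cong xy≈1) val-1)))

    from : ¬ (∃[ y ] x * elem y ≈ 1#) → val x <₋ 𝟙
    from nonUnit = compare (val x) ≡.refl x≤1
      where
      compare : ∀ γ → val x ≡ γ → γ ≤₋ 𝟙 → γ <₋ 𝟙
      compare 𝟘         eq _     = ⊥₋<[ + 0 ]
      compare (ofAdd n) eq [ p ] with n ℤₚ.≟ + 0
      ... | yes ≡.refl = contradiction (unit eq) nonUnit
      ... | no n≢0     = [ ℤₚ.≤∧≢⇒< p n≢0 ]

  infix 4 _≈ᵣ_
  record _≈ᵣ_ (x y : UnitBall) : Set where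
    constructor mk
    field difference∈𝔪 : 𝔪 (x +ₒ (-ₒ y))
  open _≈ᵣ_ public

  private
    <-+ : ∀ {x y} → val x <₋ 𝟙 → val y <₋ 𝟙 → val (x + y) <₋ 𝟙
    <-+ {x} {y} p q = ≤-<₋-trans (ultrametric x y) (max-lub-< p q)

    <-cong : ∀ {x y} → x ≈ y → val x <₋ 𝟙 → val y <₋ 𝟙
    <-cong eq = ≡.subst (_<₋ 𝟙) (val-cong eq)

    ≈⇒≈ᵣ : ∀ {x y} → elem x ≈ elem y → x ≈ᵣ y
    ≈⇒≈ᵣ {x} {y} eq = mk (≡.subst (_<₋ 𝟙)
      (≡.sym (≡.trans (val-cong (trans (+-congʳ eq) (-‿inverseʳ (elem y)))) val-0))
      ⊥₋<[ + 0 ])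

    neg-sub : ∀ x y → - (x - y) ≈ y - x
    neg-sub x y = trans (sym (-‿+-comm x (- y))) (trans (+-comm _ _) (+-congʳ (-‿involutive y)))

    telescope : ∀ x y z → (x - y) + (y - z) ≈ x - z
    telescope x y z = trans (+-assoc x (- y) (y - z))
      (+-congˡ (trans (sym (+-assoc (- y) y (- z)))
        (trans (+-congʳ (-‿inverseˡ y)) (+-identityˡ (- z)))))

    ≈ᵣ-sym : ∀ {x y} → x ≈ᵣ y → y ≈ᵣ x
    ≈ᵣ-sym {x} {y} (mk p) = mk (<-cong (neg-sub (elem x) (elem y))
      (≡.subst (_<₋ 𝟙) (≡.sym (val-neg _)) p))

    ≈ᵣ-trans : ∀ {x y z} → x ≈ᵣ y → y ≈ᵣ z → x ≈ᵣ z
    ≈ᵣ-trans {x} {y} {z} (mk p) (mk q) =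
      mk (<-cong (telescope (elem x) (elem y) (elem z)) (<-+ p q))

    +ᵣ-congˡ : ∀ x {y z} → y ≈ᵣ z → (x +ₒ y) ≈ᵣ (x +ₒ z)
    +ᵣ-congˡ (x , _) {y , _} {z , _} (mk p) = mk (<-cong (sym eq) p)
      where
      eq : (x + y) - (x + z) ≈ y - z
      eq = trans (+-cong (+-comm x y) (sym (-‿+-comm x z)))
        (trans (+-assoc y x _)
          (+-congˡ (trans (sym (+-assoc x (- x) (- z)))
            (trans (+-congʳ (-‿inverseʳ x)) (+-identityˡ (- z))))))

    *ᵣ-congˡ : ∀ x {y z} → y ≈ᵣ z → (x *ₒ y) ≈ᵣ (x *ₒ z)
    *ᵣ-congˡ (x , x≤1) {y , _} {z , _} (mk p) = mk (<-cong
      (trans (distribˡ x y (- z)) (+-congˡ (sym (-‿distribʳ-* x z))))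
      (≡.subst (_<₋ 𝟙) (≡.sym (val-* x (y - z))) (·-<𝟙 x≤1 p)))

    module 𝒪 = CommutativeRing unitBall

    +ᵣ-cong : ∀ {x x′ y y′} → x ≈ᵣ x′ → y ≈ᵣ y′ → (x +ₒ y) ≈ᵣ (x′ +ₒ y′)
    +ᵣ-cong {x} {x′} {y} {y′} p q = ≈ᵣ-trans (+ᵣ-congˡ x q)
      (≈ᵣ-trans (≈⇒≈ᵣ (+-comm _ _))
        (≈ᵣ-trans (+ᵣ-congˡ y′ p) (≈⇒≈ᵣ (+-comm _ _))))

    *ᵣ-cong : ∀ {x x′ y y′} → x ≈ᵣ x′ → y ≈ᵣ y′ → (x *ₒ y) ≈ᵣ (x′ *ₒ y′)
    *ᵣ-cong {x} {x′} {y} {y′} p q = ≈ᵣ-trans (*ᵣ-congˡ x q)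
      (≈ᵣ-trans (≈⇒≈ᵣ (*-comm _ _))
        (≈ᵣ-trans (*ᵣ-congˡ y′ p) (≈⇒≈ᵣ (*-comm _ _))))

    -ᵣ-cong : ∀ {x y} → x ≈ᵣ y → (-ₒ x) ≈ᵣ (-ₒ y)
    -ᵣ-cong {x} {y} (mk p) = mk (<-cong (sym (-‿+-comm (elem x) (- elem y)))
      (≡.subst (_<₋ 𝟙) (≡.sym (val-neg _)) p))

  -- UnitBall / 𝔪: the operations of the unit ball, equality modulo 𝔪.
  residueField : CommutativeRing c 0ℓ
  residueField = record
    { Carrier = UnitBall
    ; _≈_ = _≈ᵣ_
    ; _+_ = _+ₒ_
    ; _*_ = _*ₒ_
    ; -_  = -ₒ_
    ; 0#  = 0ₒ
    ; 1#  = 1ₒ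
    ; isCommutativeRing = record
      { isRing = record
        { +-isAbelianGroup = record
          { isGroup = record
            { isMonoid = record
              { isSemigroup = record
                { isMagma = record
                  { isEquivalence = record
                    { refl = ≈⇒≈ᵣ refl ; sym = ≈ᵣ-sym ; trans = ≈ᵣ-trans }
                  ; ∙-cong = +ᵣ-cong
                  }
                ; assoc = λ x y z → ≈⇒≈ᵣ (𝒪.+-assoc x y z)
                }
              ; identity = (λ x → ≈⇒≈ᵣ (𝒪.+-identityˡ x)) , (λ x → ≈⇒≈ᵣ (𝒪.+-identityʳ x))
              }
            ; inverse = (λ x → ≈⇒≈ᵣ (𝒪.-‿inverseˡ x)) , (λ x → ≈⇒≈ᵣ (𝒪.-‿inverseʳ x))
            ; ⁻¹-cong = -ᵣ-cong
            }
          ; comm = λ x y → ≈⇒≈ᵣ (𝒪.+-comm x y)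
          }
        ; *-cong     = *ᵣ-cong
        ; *-assoc    = λ x y z → ≈⇒≈ᵣ (𝒪.*-assoc x y z)
        ; *-identity = (λ x → ≈⇒≈ᵣ (𝒪.*-identityˡ x)) , (λ x → ≈⇒≈ᵣ (𝒪.*-identityʳ x))
        ; distrib    = (λ x y z → ≈⇒≈ᵣ (𝒪.distribˡ x y z))
                     , (λ x y z → ≈⇒≈ᵣ (𝒪.distribʳ x y z))
        }
      ; *-comm = λ x y → ≈⇒≈ᵣ (𝒪.*-comm x y)
      }
    }

  FiniteResidueField : Set c
  FiniteResidueField =
    ∃[ n ] Inverse (≡ₚ.setoid (Fin n)) (CommutativeRing.setoid residueField)

  record IsLocalField : Set (c ⊔ ℓ ⊔ lsuc 0ℓ) where
    field
      discrete           : Discrete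
      complete           : Complete
      finiteResidueField : FiniteResidueField

-- A completion of (F₀ , v₀): a complete valued field in which it is densely
-- and isometrically embedded.  These are unique up to unique isomorphism.
record Completion {c₀ ℓ₀} {F₀ : Field c₀ ℓ₀} (v₀ : Valuation F₀) c ℓ
       : Set (c₀ ⊔ ℓ₀ ⊔ lsuc (c ⊔ ℓ ⊔ 0ℓ)) where
  private module F₀ = Field F₀
  field
    completedField : Field c ℓ
    valuation      : Valuation completedField
    embedding      : RingHom F₀.commutativeRing (Field.commutativeRing completedField)
  open Field completedField
  open Valuation valuation using (val)
  open RingHom embedding using (⟦_⟧)
  field
    extends  : ∀ x → val ⟦ x ⟧ ≡ Valuation.val v₀ x
    dense    : ∀ x (n : ℤ) → ∃[ y ] val (x - ⟦ y ⟧) <₋ ofAdd n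
    complete : Complete valuation

record Extension {c ℓ} (F : Field c ℓ) c′ ℓ′ : Set (c ⊔ ℓ ⊔ lsuc (c′ ⊔ ℓ′)) where
  field
    extensionField : Field c′ ℓ′
    inclusion      : RingHom (Field.commutativeRing F) (Field.commutativeRing extensionField)

module _ {c ℓ c′ ℓ′} {F : Field c ℓ} (E : Extension F c′ ℓ′) where
  private
    module F = Field F
    K = Extension.extensionField E
    module K = Field K
  open RingHom (Extension.inclusion E) using (⟦_⟧)
  open Algebra.Properties.CommutativeMonoid.Sum K.+-commutativeMonoid using (sum)
  open Polynomial F.commutativeRing using (Poly; MonicOfDegree; SeparablePoly)

  Finite : Set (c ⊔ c′ ⊔ ℓ′)
  Finite = ∃[ n ] Σ (Fin n → K.Carrier) λ b →
    ∀ x → Σ (Fin n → F.Carrier) λ a → x K.≈ sum (λ i → ⟦ a i ⟧ K.* b i)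

  evaluate : Poly → K.Carrier → K.Carrier
  evaluate []      x = K.0#
  evaluate (a ∷ f) x = ⟦ a ⟧ K.+ x K.* evaluate f x

  IsMinimalPolynomial : Poly → K.Carrier → Set (c ⊔ ℓ ⊔ ℓ′)
  IsMinimalPolynomial f x = ∃[ n ]
    MonicOfDegree n f ×
    evaluate f x K.≈ K.0# ×
    (∀ m g → MonicOfDegree m g → evaluate g x K.≈ K.0# → n ℕ.≤ m)

  Separable : Set (c ⊔ ℓ ⊔ c′ ⊔ ℓ′)
  Separable = ∀ x → ∃[ f ] IsMinimalPolynomial f x × SeparablePoly f

  Extends : Valuation K → Valuation F → Set c
  Extends w v = ∃[ e ] 1 ℕ.≤ e × (∀ x → Valuation.val w ⟦ x ⟧ ≡ Valuation.val v x ^ e)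

module RationalFunctions {c ℓ} (D : IntegralDomain c ℓ)
  (_≟0 : ∀ x → Dec (IntegralDomain._≈_ D x (IntegralDomain.0# D))) where
  open IntegralDomain D using (_≈_; _+_; 0#; commutativeRing)
  private module D = IntegralDomain D
  open Polynomial commutativeRing

  isZero? : ∀ f → Dec (f ≈ₚ [])
  isZero? []      = yes ≈ₚ-refl
  isZero? (a ∷ f) with a ≟0 | isZero? f
  ... | yes p | yes q = yes (∷≈[] p q)
  ... | yes p | no ¬q = no (λ r → ¬q (∷≈[]⁻ r))
  ... | no ¬p | _     = no (λ r → ¬p (r .at 0))

  -- The exponent of X in f if f is nonzero; the value at 0 is never used.
  order : Poly → ℕ
  order []      = 0
  order (a ∷ f) with a ≟0
  ... | yes _ = suc (order f)
  ... | no  _ = 0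

  valueₚ : Poly → ℤₘ₀
  valueₚ f with isZero? f
  ... | yes _ = 𝟘
  ... | no  _ = ofAdd (ℤ.- (+ order f))

  order-X : ∀ {a} → a ≈ 0# → ∀ f → order (a ∷ f) ≡ suc (order f)
  order-X {a} a≈0 f with a ≟0
  ... | yes _  = ≡.refl
  ... | no a≉0 = contradiction a≈0 a≉0

  order-unit : ∀ {a} → ¬ (a ≈ 0#) → ∀ f → order (a ∷ f) ≡ 0
  order-unit {a} a≉0 f with a ≟0
  ... | yes a≈0 = contradiction a≈0 a≉0
  ... | no _    = ≡.refl

  valueₚ-X : ∀ {a} → a ≈ 0# → ∀ f → valueₚ (a ∷ f) ≡ ofAdd (ℤ.- (+ 1)) · valueₚ f
  valueₚ-X {a} a≈0 f with a ≟0 | isZero? f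
  ... | yes p | yes q = ≡.refl
  ... | yes p | no ¬q = ≡.cong just (≡.trans
        (≡.cong (λ n → ℤ.- (+ n)) (order-X a≈0 f))
        (ℤₚ.neg-distrib-+ (+ 1) (+ order f)))
  ... | no ¬p | _     = contradiction a≈0 ¬p

  valueₚ-unit : ∀ {a} → ¬ (a ≈ 0#) → ∀ f → valueₚ (a ∷ f) ≡ 𝟙
  valueₚ-unit {a} a≉0 f with a ≟0 | isZero? f
  ... | yes p | _ = contradiction p a≉0
  ... | no ¬p | _ = ≡.cong (λ n → ofAdd (ℤ.- (+ n))) (order-unit a≉0 f)

  valueₚ≡𝟘 : ∀ f → valueₚ f ≡ 𝟘 → f ≈ₚ []
  valueₚ≡𝟘 f eq with isZero? f
  ... | yes p = p

  valueₚ-zero : ∀ {f} → f ≈ₚ [] → valueₚ f ≡ 𝟘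
  valueₚ-zero {f} f≈0 with isZero? f
  ... | yes _ = ≡.refl
  ... | no ¬p = contradiction f≈0 ¬p

  valueₚ≢𝟘 : ∀ {f} → ¬ (f ≈ₚ []) → ∃[ n ] valueₚ f ≡ ofAdd n
  valueₚ≢𝟘 {f} f≉0 with isZero? f
  ... | yes p = contradiction p f≉0
  ... | no _  = _ , ≡.refl

  valueₚ-cong : ∀ {f g} → f ≈ₚ g → valueₚ f ≡ valueₚ g
  valueₚ-cong {[]}    {g}     p = ≡.sym (valueₚ-zero (≈ₚ-sym p))
  valueₚ-cong {a ∷ f} {[]}    p = valueₚ-zero p
  valueₚ-cong {a ∷ f} {b ∷ g} p = go (a ≟0)
    where
    go : Dec (a ≈ 0#) → valueₚ (a ∷ f) ≡ valueₚ (b ∷ g)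
    go (yes a≈0) = ≡.trans (valueₚ-X a≈0 f)
      (≡.trans (≡.cong (ofAdd (ℤ.- (+ 1)) ·_) (valueₚ-cong (tail-cong p)))
        (≡.sym (valueₚ-X (D.trans (D.sym (p .at 0)) a≈0) g)))
    go (no a≉0)  = ≡.trans (valueₚ-unit a≉0 f)
      (≡.sym (valueₚ-unit (λ b≈0 → a≉0 (D.trans (p .at 0) b≈0)) g))

  private
    unit-* : ∀ {a} → ¬ (a ≈ 0#) → ∀ f g → valueₚ ((a ∷ f) *ₚ g) ≡ valueₚ g
    unit-* {a} a≉0 f []      = valueₚ-zero (*ₚ-zeroʳ (a ∷ f))
    unit-* {a} a≉0 f (b ∷ g) = go (b ≟0)
      where
      go : Dec (b ≈ 0#) → valueₚ ((a ∷ f) *ₚ (b ∷ g)) ≡ valueₚ (b ∷ g)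
      go (yes b≈0) = begin
        valueₚ ((a ∷ f) *ₚ (b ∷ g))
          ≡⟨ valueₚ-cong (≈ₚ-trans (*ₚ-∷ (a ∷ f) b g)
               (R.+-cong (0-scale b≈0 (a ∷ f)) ≈ₚ-refl)) ⟩
        valueₚ (shift ((a ∷ f) *ₚ g))
          ≡⟨ valueₚ-X D.refl ((a ∷ f) *ₚ g) ⟩
        ofAdd (ℤ.- (+ 1)) · valueₚ ((a ∷ f) *ₚ g)
          ≡⟨ ≡.cong (ofAdd (ℤ.- (+ 1)) ·_) (unit-* a≉0 f g) ⟩
        ofAdd (ℤ.- (+ 1)) · valueₚ g
          ≡⟨ valueₚ-X b≈0 g ⟨
        valueₚ (b ∷ g) ∎
        where
        open ≡ₚ.≡-Reasoning
        module R = CommutativeRing polynomialRing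
      go (no b≉0) = ≡.trans
        (valueₚ-unit (λ eq → Sum.[ a≉0 , b≉0 ]
            (D.noZeroDivisors a b (D.trans (D.sym (D.+-identityʳ _)) eq))) _)
        (≡.sym (valueₚ-unit b≉0 g))

  valueₚ-* : ∀ f g → valueₚ (f *ₚ g) ≡ valueₚ f · valueₚ g
  valueₚ-* []      g = ≡.refl
  valueₚ-* (a ∷ f) g = go (a ≟0)
    where
    open ≡ₚ.≡-Reasoning
    go : Dec (a ≈ 0#) → valueₚ ((a ∷ f) *ₚ g) ≡ valueₚ (a ∷ f) · valueₚ g
    go (yes a≈0) = begin
      valueₚ ((a ∷ f) *ₚ g)                   ≡⟨ valueₚ-cong (∷-*ₚ a≈0 f g) ⟩
      valueₚ (shift (f *ₚ g))                 ≡⟨ valueₚ-X D.refl (f *ₚ g) ⟩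
      ofAdd (ℤ.- (+ 1)) · valueₚ (f *ₚ g)     ≡⟨ ≡.cong (ofAdd (ℤ.- (+ 1)) ·_) (valueₚ-* f g) ⟩
      ofAdd (ℤ.- (+ 1)) · (valueₚ f · valueₚ g) ≡⟨ ·-assoc (ofAdd (ℤ.- (+ 1))) (valueₚ f) (valueₚ g) ⟨
      (ofAdd (ℤ.- (+ 1)) · valueₚ f) · valueₚ g ≡⟨ ≡.cong (_· valueₚ g) (valueₚ-X a≈0 f) ⟨
      valueₚ (a ∷ f) · valueₚ g ∎
    go (no a≉0) = begin
      valueₚ ((a ∷ f) *ₚ g)     ≡⟨ unit-* a≉0 f g ⟩
      valueₚ g                  ≡⟨ ·-identityˡ (valueₚ g) ⟨
      𝟙 · valueₚ g              ≡⟨ ≡.cong (_· valueₚ g) (valueₚ-unit a≉0 f) ⟨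
      valueₚ (a ∷ f) · valueₚ g ∎

  valueₚ≤𝟙 : ∀ f → valueₚ f ≤₋ 𝟙
  valueₚ≤𝟙 f with isZero? f
  ... | yes _ = ⊥₋≤ 𝟙
  ... | no  _ = [ ℤₚ.neg-mono-≤ (ℤ.+≤+ ℕ.z≤n) ]

  valueₚ-+ : ∀ f g → valueₚ (f +ₚ g) ≤₋ max (valueₚ f) (valueₚ g)
  valueₚ-+ []      g       = ≤₋-refl
  valueₚ-+ (a ∷ f) []      = ≤-maxˡ (valueₚ (a ∷ f)) 𝟘
  valueₚ-+ (a ∷ f) (b ∷ g) = go (a ≟0) (b ≟0)
    where
    bound = max (valueₚ (a ∷ f)) (valueₚ (b ∷ g))
    go : Dec (a ≈ 0#) → Dec (b ≈ 0#) → valueₚ (a + b ∷ f +ₚ g) ≤₋ bound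
    go (no a≉0) _ = ≤₋-trans (valueₚ≤𝟙 _)
      (≡.subst (_≤₋ bound) (valueₚ-unit a≉0 f) (≤-maxˡ _ _))
    go _ (no b≉0) = ≤₋-trans (valueₚ≤𝟙 _)
      (≡.subst (_≤₋ bound) (valueₚ-unit b≉0 g) (≤-maxʳ (valueₚ (a ∷ f)) _))
    go (yes a≈0) (yes b≈0) = ≡.subst₂ _≤₋_
      (≡.sym (valueₚ-X (D.trans (D.+-cong a≈0 b≈0) (D.+-identityʳ 0#)) (f +ₚ g)))
      (≡.trans (·-distribˡ-max (ofAdd (ℤ.- (+ 1))) (valueₚ f) (valueₚ g))
        (≡.cong₂ max (≡.sym (valueₚ-X a≈0 f)) (≡.sym (valueₚ-X b≈0 g))))
      (·-monoʳ-≤ (ofAdd (ℤ.- (+ 1))) (valueₚ-+ f g))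

  polynomialDomain : IntegralDomain c ℓ
  polynomialDomain = record
    { commutativeRing = polynomialRing
    ; 1≉0             = λ p → D.1≉0 (p .at 0)
    ; noZeroDivisors  = λ f g fg≈0 → Sum.map (valueₚ≡𝟘 f) (valueₚ≡𝟘 g)
        (·-integral (valueₚ f) (valueₚ g)
          (≡.trans (≡.sym (valueₚ-* f g)) (valueₚ-zero fg≈0)))
    }

  open Fractions polynomialDomain

  rationalFunctions : Field (c ⊔ ℓ) ℓ
  rationalFunctions = fractionField

  X-adic : Fraction → ℤₘ₀
  X-adic x with isZero? (num x)
  ... | yes _ = 𝟘
  ... | no  _ = ofAdd (ℤ.- (+ order (num x) ℤ.- + order (den x)))

  X-adic-den : ∀ x → X-adic x · valueₚ (den x) ≡ valueₚ (num x)
  X-adic-den x with isZero? (num x) | isZero? (den x)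
  ... | yes _ | _     = ≡.refl
  ... | no  _ | yes p = contradiction p (den≉0 x)
  ... | no  _ | no  _ = ≡.cong just (lemma (+ order (num x)) (+ order (den x)))
    where
    open +-*-Solver
    lemma : ∀ m n → ℤ.- (m ℤ.- n) ℤ.+ ℤ.- n ≡ ℤ.- m
    lemma = solve 2 (λ m n → (:- (m :- n)) :+ (:- n) := :- m) ≡.refl

  private
    cancel-den : ∀ x {γ δ} → γ · valueₚ (den x) ≡ δ · valueₚ (den x) → γ ≡ δ
    cancel-den x {γ} {δ} eq with valueₚ≢𝟘 (den≉0 x)
    ... | n , p = ·-cancelʳ n (≡.subst (λ ε → γ · ε ≡ δ · ε) p eq)

    cancel-den-≤ : ∀ x {γ δ} → γ · valueₚ (den x) ≤₋ δ · valueₚ (den x) → γ ≤₋ δ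
    cancel-den-≤ x {γ} {δ} le with valueₚ≢𝟘 (den≉0 x)
    ... | n , p = ·-cancelʳ-≤ n (≡.subst (λ ε → γ · ε ≤₋ δ · ε) p le)

    X-adic-cross : ∀ x y →
      X-adic x · valueₚ (den x *ₚ den y) ≡ valueₚ (num x *ₚ den y)
    X-adic-cross x y = begin
      X-adic x · valueₚ (den x *ₚ den y)
        ≡⟨ ≡.cong (X-adic x ·_) (valueₚ-* (den x) (den y)) ⟩
      X-adic x · (valueₚ (den x) · valueₚ (den y))
        ≡⟨ ·-assoc (X-adic x) (valueₚ (den x)) (valueₚ (den y)) ⟨
      (X-adic x · valueₚ (den x)) · valueₚ (den y)
        ≡⟨ ≡.cong (_· valueₚ (den y)) (X-adic-den x) ⟩
      valueₚ (num x) · valueₚ (den y)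
        ≡⟨ valueₚ-* (num x) (den y) ⟨
      valueₚ (num x *ₚ den y) ∎
      where open ≡ₚ.≡-Reasoning

    X-adic-cong : ∀ {x y} → x ≈ᶠ y → X-adic x ≡ X-adic y
    X-adic-cong {x} {y} (mk p) = cancel-den (x *ᶠ y) (begin
      X-adic x · valueₚ (den x *ₚ den y) ≡⟨ X-adic-cross x y ⟩
      valueₚ (num x *ₚ den y)            ≡⟨ valueₚ-cong p ⟩
      valueₚ (num y *ₚ den x)            ≡⟨ X-adic-cross y x ⟨
      X-adic y · valueₚ (den y *ₚ den x)
        ≡⟨ ≡.cong (X-adic y ·_) (valueₚ-cong (*ₚ-comm (den y) (den x))) ⟩
      X-adic y · valueₚ (den x *ₚ den y) ∎)
      where open ≡ₚ.≡-Reasoning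

    X-adic-* : ∀ x y → X-adic (x *ᶠ y) ≡ X-adic x · X-adic y
    X-adic-* x y = cancel-den (x *ᶠ y) (begin
      X-adic (x *ᶠ y) · valueₚ (den x *ₚ den y)
        ≡⟨ X-adic-den (x *ᶠ y) ⟩
      valueₚ (num x *ₚ num y)
        ≡⟨ valueₚ-* (num x) (num y) ⟩
      valueₚ (num x) · valueₚ (num y)
        ≡⟨ ≡.cong₂ _·_ (X-adic-den x) (X-adic-den y) ⟨
      (X-adic x · valueₚ (den x)) · (X-adic y · valueₚ (den y))
        ≡⟨ ·-interchange (X-adic x) (valueₚ (den x)) (X-adic y) (valueₚ (den y)) ⟩
      (X-adic x · X-adic y) · (valueₚ (den x) · valueₚ (den y))
        ≡⟨ ≡.cong ((X-adic x · X-adic y) ·_) (valueₚ-* (den x) (den y)) ⟨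
      (X-adic x · X-adic y) · valueₚ (den x *ₚ den y) ∎)
      where open ≡ₚ.≡-Reasoning

    X-adic-+ : ∀ x y → X-adic (x +ᶠ y) ≤₋ max (X-adic x) (X-adic y)
    X-adic-+ x y = cancel-den-≤ (x *ᶠ y) (≡.subst₂ _≤₋_
      (≡.sym (X-adic-den (x +ᶠ y)))
      (begin
        max (valueₚ (num x *ₚ den y)) (valueₚ (num y *ₚ den x))
          ≡⟨ ≡.cong₂ max (X-adic-cross x y) (X-adic-cross y x) ⟨
        max (X-adic x · v) (X-adic y · valueₚ (den y *ₚ den x))
          ≡⟨ ≡.cong (λ ε → max (X-adic x · v) (X-adic y · ε))
               (valueₚ-cong (*ₚ-comm (den y) (den x))) ⟩
        max (X-adic x · v) (X-adic y · v)
          ≡⟨ ≡.cong₂ max (·-comm (X-adic x) v) (·-comm (X-adic y) v) ⟩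
        max (v · X-adic x) (v · X-adic y)
          ≡⟨ ·-distribˡ-max v (X-adic x) (X-adic y) ⟨
        v · max (X-adic x) (X-adic y)
          ≡⟨ ·-comm v (max (X-adic x) (X-adic y)) ⟩
        max (X-adic x) (X-adic y) · v ∎)
      (valueₚ-+ (num x *ₚ den y) (num y *ₚ den x)))
      where
      open ≡ₚ.≡-Reasoning
      v = valueₚ (den x *ₚ den y)

  X-adicValuation : Valuation rationalFunctions
  X-adicValuation = record
    { val         = X-adic
    ; val-cong    = X-adic-cong
    ; val-0       = ≡.refl
    ; val-1       = ≡.trans (≡.sym (·-identityʳ (X-adic 1ᶠ))) (≡.trans
        (≡.cong (X-adic 1ᶠ ·_) (≡.sym (valueₚ-unit D.1≉0 [])))
        (≡.trans (X-adic-den 1ᶠ) (valueₚ-unit D.1≉0 [])))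
    ; val-*       = X-adic-*
    ; ultrametric = X-adic-+
    }

-- 𝔽ₚ is ℤ with congruence modulo p as its equality.

module _ (p : ℕ) (prime : Prime p) where

  record Congruent (a b : ℤ) : Set where
    constructor mk
    field divides-difference : + p ∣ a ℤ.- b
  open Congruent public

  private
    infix 4 _≈_
    _≈_ = Congruent

    by : ∀ {a b i} → i ≡ a ℤ.- b → + p ∣ i → a ≈ b
    by eq d = mk (≡.subst (+ p ∣_) eq d)

    ≡⇒≈ : ∀ {a b} → a ≡ b → a ≈ b
    ≡⇒≈ {a} ≡.refl = by (≡.sym (ℤₚ.+-inverseʳ a)) (divides (+ 0) ≡.refl)

    open +-*-Solver

    sym-eq : ∀ a b → ℤ.- (a ℤ.- b) ≡ b ℤ.- a
    sym-eq = solve 2 (λ a b → :- (a :- b) := b :- a) ≡.refl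

    trans-eq : ∀ a b c → (a ℤ.- b) ℤ.+ (b ℤ.- c) ≡ a ℤ.- c
    trans-eq = solve 3 (λ a b c → (a :- b) :+ (b :- c) := a :- c) ≡.refl

    +-eq : ∀ a a′ b b′ → (a ℤ.- a′) ℤ.+ (b ℤ.- b′) ≡ (a ℤ.+ b) ℤ.- (a′ ℤ.+ b′)
    +-eq = solve 4 (λ a a′ b b′ →
      (a :- a′) :+ (b :- b′) := (a :+ b) :- (a′ :+ b′)) ≡.refl

    neg-eq : ∀ a b → ℤ.- (a ℤ.- b) ≡ ℤ.- a ℤ.- ℤ.- b
    neg-eq = solve 2 (λ a b → :- (a :- b) := (:- a) :- (:- b)) ≡.refl

    *-eq : ∀ a a′ b b′ →
      b ℤ.* (a ℤ.- a′) ℤ.+ a′ ℤ.* (b ℤ.- b′) ≡ a ℤ.* b ℤ.- a′ ℤ.* b′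
    *-eq = solve 4 (λ a a′ b b′ →
      (b :* (a :- a′)) :+ (a′ :* (b :- b′)) := (a :* b) :- (a′ :* b′)) ≡.refl

  𝔽ₚ-ring : CommutativeRing 0ℓ 0ℓ
  𝔽ₚ-ring = record
    { Carrier = ℤ
    ; _≈_ = _≈_
    ; _+_ = ℤ._+_
    ; _*_ = ℤ._*_
    ; -_  = ℤ.-_
    ; 0#  = + 0
    ; 1#  = + 1
    ; isCommutativeRing = record
      { isRing = record
        { +-isAbelianGroup = record
          { isGroup = record
            { isMonoid = record
              { isSemigroup = record
                { isMagma = record
                  { isEquivalence = record
                    { refl  = ≡⇒≈ ≡.refl
                    ; sym   = λ {a} {b} (mk d) → by (sym-eq a b) (∣m⇒∣-m d)
                    ; trans = λ {a} {b} {c} (mk d) (mk e) → by (trans-eq a b c) (∣m∣n⇒∣m+n d e)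
                    }
                  ; ∙-cong = λ {a} {a′} {b} {b′} (mk d) (mk e) → by (+-eq a a′ b b′) (∣m∣n⇒∣m+n d e)
                  }
                ; assoc = λ a b c → ≡⇒≈ (ℤₚ.+-assoc a b c)
                }
              ; identity = (λ a → ≡⇒≈ (ℤₚ.+-identityˡ a)) , (λ a → ≡⇒≈ (ℤₚ.+-identityʳ a))
              }
            ; inverse = (λ a → ≡⇒≈ (ℤₚ.+-inverseˡ a)) , (λ a → ≡⇒≈ (ℤₚ.+-inverseʳ a))
            ; ⁻¹-cong = λ {a} {b} (mk d) → by (neg-eq a b) (∣m⇒∣-m d)
            }
          ; comm = λ a b → ≡⇒≈ (ℤₚ.+-comm a b)
          }
        ; *-cong     = λ {a} {a′} {b} {b′} (mk d) (mk e) → by (*-eq a a′ b b′)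
            (∣m∣n⇒∣m+n (∣n⇒∣m*n b d) (∣n⇒∣m*n a′ e))
        ; *-assoc    = λ a b c → ≡⇒≈ (ℤₚ.*-assoc a b c)
        ; *-identity = (λ a → ≡⇒≈ (ℤₚ.*-identityˡ a)) , (λ a → ≡⇒≈ (ℤₚ.*-identityʳ a))
        ; distrib    = (λ a b c → ≡⇒≈ (ℤₚ.*-distribˡ-+ a b c))
                     , (λ a b c → ≡⇒≈ (ℤₚ.*-distribʳ-+ a b c))
        }
      ; *-comm = λ a b → ≡⇒≈ (ℤₚ.*-comm a b)
      }
    }

  private
    ≈0⇒∣ : ∀ {a} → a ≈ + 0 → p ℕ∣.∣ ℤ.∣ a ∣
    ≈0⇒∣ {a} (mk d) = ∣⇒∣ᵤ (≡.subst (+ p ∣_) (ℤₚ.+-identityʳ a) d)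

    ∣⇒≈0 : ∀ {a} → p ℕ∣.∣ ℤ.∣ a ∣ → a ≈ + 0
    ∣⇒≈0 {a} d = by (≡.sym (ℤₚ.+-identityʳ a)) (∣ᵤ⇒∣ d)

  𝔽ₚ : IntegralDomain 0ℓ 0ℓ
  𝔽ₚ = record
    { commutativeRing = 𝔽ₚ-ring
    ; 1≉0             = λ eq → ¬prime[1] (≡.subst Prime (ℕ∣.∣1⇒≡1 (≈0⇒∣ eq)) prime)
    ; noZeroDivisors  = λ a b eq → Sum.map ∣⇒≈0 ∣⇒≈0
        (euclidsLemma ℤ.∣ a ∣ ℤ.∣ b ∣ prime
          (≡.subst (p ℕ∣.∣_) (ℤₚ.abs-* a b) (≈0⇒∣ eq)))
    }

  𝔽ₚ-zero? : ∀ a → Dec (Congruent a (+ 0))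
  𝔽ₚ-zero? a = map′ mk (λ eq → eq .divides-difference) (+ p ∣? (a ℤ.- + 0))

  𝔽ₚ⟨X⟩-valuation : Valuation (RationalFunctions.rationalFunctions 𝔽ₚ 𝔽ₚ-zero?)
  𝔽ₚ⟨X⟩-valuation = RationalFunctions.X-adicValuation 𝔽ₚ 𝔽ₚ-zero?

-- Let K/F be finite, F a local field with uniformizer ϖ.  Adjoining one vector
-- to an F-subspace of K enlarges the set of residues of its integral elements
-- by at most one generator over the residue field of F, so K has finite residue
-- field, and by refinement the unit ball of K has a finite net modulo ϖ.
-- Expanding in digits from this net, a Cauchy sequence of K becomes a
-- combination of the finitely many net points with coefficients that are Cauchy
-- sequences in F, so K is complete.  The completion of 𝔽ₚ(X) is local because
-- every X-adically integral rational function is congruent to a constant.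
module Submission where

open import Defs
import Algebra.Definitions.RawMonoid
import Algebra.Properties.AbelianGroup
import Algebra.Properties.CommutativeSemigroup
import Algebra.Properties.Ring
import Algebra.Properties.Semiring.Exp
open import Algebra.Bundles using (CommutativeRing)
open import Axiom.ExcludedMiddle using (ExcludedMiddle)
open import Data.Fin.Base using (Fin; zero; suc; toℕ; fromℕ<; combine; remQuot)
open import Data.Fin.Properties using (toℕ-fromℕ<; remQuot-combine)
open import Data.Integer.Base as ℤ using (ℤ; +_; -[1+_])
open import Data.Integer.DivMod using (_%ℕ_; _/ℕ_; n%ℕd<d; a≡a%ℕn+[a/ℕn]*n)
open import Data.Integer.Divisibility.Signed using (divides)
import Data.Integer.Properties as ℤₚ
open import Data.Integer.Solver using (module +-*-Solver)
open import Data.List.Base using ([]; _∷_)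
open import Data.Maybe.Base using (just)
open import Data.Nat.Base as ℕ using (ℕ; zero; suc)
import Data.Nat.Properties as ℕₚ
open import Data.Nat.Coprimality using (Coprime; coprime-Bézout; prime⇒coprime)
open import Data.Nat.GCD using (module Bézout)
open Bézout.Identity using (+-; -+)
open import Data.Nat.Primality using (Prime; prime⇒nonZero)
open import Data.Product.Base using (Σ; ∃-syntax; _×_; _,_; proj₁; proj₂)
open import Data.Sum.Base using (_⊎_; inj₁; inj₂)
open import Data.Vec.Functional using (updateAt)
open import Function.Base using (_∘_)
open import Function.Bundles using (Inverse)
open import Level using (_⊔_)
open import Relation.Binary.PropositionalEquality
  using (_≡_; _≢_; module ≡-Reasoning; refl; sym; trans; cong; subst; subst₂)
import Relation.Binary.Reasoning.Setoid as SetoidReasoning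
open import Relation.Nullary.Decidable.Core using (Dec; yes; no)
open import Relation.Nullary.Negation.Core using (¬_; contradiction)
open import Relation.Unary using (Pred)

-- Order and powers in the value group with zero.

<₋⇒≤₋ : ∀ {γ δ} → γ <₋ δ → γ ≤₋ δ
<₋⇒≤₋ ⊥₋<[ n ] = ⊥₋≤ _
<₋⇒≤₋ [ m<n ]  = [ ℤₚ.<⇒≤ m<n ]

<₋-≤₋-trans : ∀ {γ δ η} → γ <₋ δ → δ ≤₋ η → γ <₋ η
<₋-≤₋-trans ⊥₋<[ _ ] [ _ ]   = ⊥₋<[ _ ]
<₋-≤₋-trans [ p ]    [ q ]   = [ ℤₚ.<-≤-trans p q ]

<₋-irrefl : ∀ {γ} → ¬ (γ <₋ γ)
<₋-irrefl [ p ] = ℤₚ.<-irrefl refl p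

≤₋-<₋-connex : ∀ γ δ → γ ≤₋ δ ⊎ δ <₋ γ
≤₋-<₋-connex 𝟘         δ = inj₁ (⊥₋≤ δ)
≤₋-<₋-connex (ofAdd m) 𝟘 = inj₂ ⊥₋<[ m ]
≤₋-<₋-connex (ofAdd m) (ofAdd n) with m ℤₚ.≤? n
... | yes m≤n = inj₁ [ m≤n ]
... | no  m≰n = inj₂ [ ℤₚ.≰⇒> m≰n ]

≤₋-reflexive : ∀ {γ δ} → γ ≡ δ → γ ≤₋ δ
≤₋-reflexive refl = ≤₋-refl

·-mono-≤ : ∀ {α β γ δ} → α ≤₋ β → γ ≤₋ δ → α · γ ≤₋ β · δ
·-mono-≤ {α} {β} {γ} {δ} p q = ≤₋-trans (·-monoʳ-≤ α q)
  (subst₂ _≤₋_ (·-comm δ α) (·-comm δ β) (·-monoʳ-≤ δ p))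

·-monoʳ-< : ∀ m {γ δ} → γ <₋ δ → ofAdd m · γ <₋ ofAdd m · δ
·-monoʳ-< m ⊥₋<[ n ] = ⊥₋<[ _ ]
·-monoʳ-< m [ p ]    = [ ℤₚ.+-monoʳ-< m p ]

·-cancelʳ-< : ∀ {γ δ} n → γ · ofAdd n <₋ δ · ofAdd n → γ <₋ δ
·-cancelʳ-< {γ} {δ} n p with ≤₋-<₋-connex δ γ
... | inj₁ δ≤γ = contradiction (<₋-≤₋-trans p (·-mono-≤ δ≤γ ≤₋-refl)) <₋-irrefl
... | inj₂ γ<δ = γ<δ

-- Values are integers, so nothing lies strictly between `ofAdd` of -1 and `𝟙`. This turns
-- congruence modulo `𝔪` into a closed radius bound.
<𝟙⇒≤ : ∀ {γ} → γ <₋ 𝟙 → γ ≤₋ ofAdd (ℤ.- (+ 1))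
<𝟙⇒≤ ⊥₋<[ _ ] = ⊥₋≤ _
<𝟙⇒≤ [ p ]    = [ ℤₚ.i<j⇒i≤pred[j] p ]

^-monoˡ-≤ : ∀ n {γ δ} → γ ≤₋ δ → γ ^ n ≤₋ δ ^ n
^-monoˡ-≤ zero    p = ≤₋-refl
^-monoˡ-≤ (suc n) p = ·-mono-≤ p (^-monoˡ-≤ n p)

^-≤𝟙 : ∀ n {γ} → γ ≤₋ 𝟙 → γ ^ n ≤₋ 𝟙
^-≤𝟙 zero    p = ≤₋-refl
^-≤𝟙 (suc n) p = ·-≤𝟙 p (^-≤𝟙 n p)

^-≤ : ∀ {n γ} → 1 ℕ.≤ n → γ ≤₋ 𝟙 → γ ^ n ≤₋ γ
^-≤ {suc n} {γ} _ p = ≤₋-trans (·-monoʳ-≤ γ (^-≤𝟙 n p)) (≤₋-reflexive (·-identityʳ γ))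

ofAdd[-1]^ : ∀ n → ofAdd (ℤ.- (+ 1)) ^ n ≡ ofAdd (ℤ.- (+ n))
ofAdd[-1]^ zero    = refl
ofAdd[-1]^ (suc n) = trans (cong (ofAdd (ℤ.- (+ 1)) ·_) (ofAdd[-1]^ n))
  (cong just (sym (ℤₚ.neg-distrib-+ (+ 1) (+ n))))

ofAdd-archimedean : ∀ n → ∃[ k ] ofAdd (ℤ.- (+ k)) <₋ ofAdd n
ofAdd-archimedean (+ n)    = 1 , [ ℤ.-<+ ]
-- `-[1+ n ]` is -(n + 1), so n + 2 is the first exponent that makes the inequality strict.
ofAdd-archimedean -[1+ n ] = suc (suc n) , [ ℤ.-<- ℕₚ.≤-refl ]

-- Arithmetic, finite nets and limits in a valued field.

module ValuedField (em : ∀ {a} → ExcludedMiddle a)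
  {c ℓ} {F : Field c ℓ} (v : Valuation F) where
  open Field F hiding (refl; sym; trans; zero)
  open Valuation v
  open Algebra.Properties.AbelianGroup +-abelianGroup
    using (//-rightDividesˡ; ⁻¹-anti-homo‿-; ⁻¹-∙-comm)
  open Algebra.Properties.Ring ring using (-‿distribˡ-*; -‿distribʳ-*)
  open Algebra.Properties.Semiring.Exp semiring public
    using () renaming (_^_ to _^ᶠ_)
  private
    module ≈ = Field F
    module R = CommutativeRing (residueField v)

  val-≈0 : ∀ {x} → x ≈ 0# → val x ≡ 𝟘
  val-≈0 x≈0 = trans (val-cong x≈0) val-0

  -- The values of `x` and of its inverse have product `𝟙`, and `𝟘` is absorbing.
  val-≉0 : ∀ {x} → x ≉ 0# → ∃[ n ] val x ≡ ofAdd n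
  val-≉0 {x} x≉0 = nonzero (val x) (val y)
    (trans (sym (val-* x y)) (trans (val-cong xy≈1) val-1))
    where
    y = proj₁ (inverse x x≉0)
    xy≈1 = proj₂ (inverse x x≉0)
    nonzero : ∀ γ δ → γ · δ ≡ 𝟙 → ∃[ n ] γ ≡ ofAdd n
    nonzero (ofAdd n) δ eq = n , refl

  val>⇒≉0 : ∀ {x γ} → γ <₋ val x → x ≉ 0#
  val>⇒≉0 {γ = γ} p x≈0 with subst (γ <₋_) (val-≈0 x≈0) p
  ... | ()

  val-ofAdd⇒≉0 : ∀ {x n} → val x ≡ ofAdd n → x ≉ 0#
  val-ofAdd⇒≉0 {n = n} p = val>⇒≉0 (subst (𝟘 <₋_) (sym p) ⊥₋<[ n ])

  val-^ : ∀ x n → val (x ^ᶠ n) ≡ val x ^ n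
  val-^ x zero    = val-1
  val-^ x (suc n) = trans (val-* x (x ^ᶠ n)) (cong (val x ·_) (val-^ x n))

  sub-telescope : ∀ x y z → (x - y) + (y - z) ≈ x - z
  sub-telescope x y z = ≈.trans (≈.sym (+-assoc (x - y) y (- z)))
    (+-congʳ (//-rightDividesˡ y x))

  val-sub-sym : ∀ x y → val (x - y) ≡ val (y - x)
  val-sub-sym x y = trans (sym (val-neg v (x - y))) (val-cong (⁻¹-anti-homo‿- x y))

  val-sub-self : ∀ {x y} → x ≈ y → val (x - y) ≡ 𝟘
  val-sub-self {y = y} x≈y = val-≈0 (≈.trans (+-congʳ x≈y) (-‿inverseʳ y))

  sub-sub : ∀ x y z → (x - y) - z ≈ x - (y + z)
  sub-sub x y z = ≈.trans (+-assoc x (- y) (- z)) (+-congˡ (⁻¹-∙-comm y z))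

  val-+-≤ : ∀ {x y γ} → val x ≤₋ γ → val y ≤₋ γ → val (x + y) ≤₋ γ
  val-+-≤ {x} {y} p q = ≤₋-trans (ultrametric x y) (max-lub p q)

  val-sub-trans : ∀ {x z γ} y →
    val (x - y) ≤₋ γ → val (y - z) ≤₋ γ → val (x - z) ≤₋ γ
  val-sub-trans {x} {z} {γ} y p q =
    subst (_≤₋ γ) (val-cong (sub-telescope x y z)) (val-+-≤ p q)

  *-sub : ∀ x y z → x * (y - z) ≈ x * y - x * z
  *-sub x y z = ≈.trans (distribˡ x y (- z)) (+-congˡ (≈.sym (-‿distribʳ-* x z)))

  sub-* : ∀ x y z → (x - y) * z ≈ x * z - y * z
  sub-* x y z = ≈.trans (distribʳ z x (- y)) (+-congˡ (≈.sym (-‿distribˡ-* y z)))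

  quotient : ∀ x {y} → y ≉ 0# → ∃[ q ] x ≈ q * y
  quotient x {y} y≉0 with inverse y y≉0
  ... | z , yz≈1 = x * z , ≈.sym (≈.trans (*-assoc x z y)
    (≈.trans (*-congˡ (≈.trans (*-comm z y) yz≈1)) (*-identityʳ x)))

  val-quotient-≤ : ∀ {x y q} → y ≉ 0# → x ≈ q * y → val x ≤₋ val y → val q ≤₋ 𝟙
  val-quotient-≤ {x} {y} {q} y≉0 x≈qy p with val-≉0 y≉0
  ... | n , eq = ·-cancelʳ-≤ n (subst₂ _≤₋_
    (trans (val-cong x≈qy) (trans (val-* q y) (cong (val q ·_) eq)))
    (trans eq (sym (·-identityˡ (ofAdd n)))) p)

  val-quotient-< : ∀ {x y q} → y ≉ 0# → x ≈ q * y → val x <₋ val y → val q <₋ 𝟙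
  val-quotient-< {x} {y} {q} y≉0 x≈qy p with val-≉0 y≉0
  ... | n , eq = ·-cancelʳ-< n (subst₂ _<₋_
    (trans (val-cong x≈qy) (trans (val-* q y) (cong (val q ·_) eq)))
    (trans eq (sym (·-identityˡ (ofAdd n)))) p)

  -- Total boundedness of the unit ball at scale `δ`. Points may be congruent to each other; at
  -- radius `ofAdd` of -1 such a net is equivalent to finiteness of the residue field.
  record FiniteNet (δ : ℤₘ₀) : Set c where
    field
      size  : ℕ
      point : Fin size → UnitBall v
      near  : ∀ (x : UnitBall v) → ∃[ i ] val (elem x - elem (point i)) ≤₋ δ

    -- Division by `d` carries the ball of radius `val d` to the unit ball, where the net applies;
    -- multiplying back scales the error by `val d`.
    near-scaled : ∀ {d} → d ≉ 0# → ∀ {x} → val x ≤₋ val d →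
      ∃[ i ] val (x - d * elem (point i)) ≤₋ val d · δ
    near-scaled {d} d≉0 {x} p = proj₁ u-near , subst (_≤₋ val d · δ)
        (trans (sym (val-* d _)) (val-cong
          (≈.trans (*-sub d u _) (+-congʳ (≈.trans (*-comm d u) (≈.sym x≈ud))))))
        (·-monoʳ-≤ (val d) (proj₂ u-near))
      where
      u = proj₁ (quotient x d≉0)
      x≈ud = proj₂ (quotient x d≉0)
      u-near = near (u , val-quotient-≤ d≉0 x≈ud p)

  unitNet : FiniteNet 𝟙
  unitNet = record
    { size  = 1
    ; point = λ _ → R.0#
    ; near  = λ x → zero , elem≤ (x R.+ (R.- R.0#))
    }

  -- A two-digit expansion: a point of `M` leaves a remainder of value at most `val d`, which is `d`
  -- times an element that `N` approximates.
  refineNet : ∀ {δ} d → d ≉ 0# → val d ≤₋ 𝟙 →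
    FiniteNet (val d) → FiniteNet δ → FiniteNet (val d · δ)
  refineNet {δ} d d≉0 d≤1 M N = record
    { size  = M.size ℕ.* N.size
    ; point = λ ij → let (i , j) = remQuot N.size ij in
        M.point i R.+ ((d , d≤1) R.* N.point j)
    ; near  = λ x → let
        (i , p) = M.near x
        (j , q) = N.near-scaled d≉0 p
      in combine i j , subst
        (λ (i , j) → val (elem x - (elem (M.point i) + d * elem (N.point j))) ≤₋ val d · δ)
        (sym (remQuot-combine i j))
        (subst (_≤₋ val d · δ) (val-cong (sub-sub _ _ _)) q)
    }
    where
    module M = FiniteNet M
    module N = FiniteNet N

  -- The points are expansions with n digits in base `π`, the digits being points of `N`.
  radiusNet : ∀ {π} → val π ≡ ofAdd (ℤ.- (+ 1)) → FiniteNet (ofAdd (ℤ.- (+ 1))) →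
    ∀ n → FiniteNet (ofAdd (ℤ.- (+ 1)) ^ n)
  radiusNet {π} eq N zero    = unitNet
  radiusNet {π} eq N (suc n) = subst FiniteNet
    (trans (cong (_· γ) val-π^n) (·-comm (γ ^ n) γ))
    (refineNet (π ^ᶠ n) (val-ofAdd⇒≉0 (trans val-π^n (ofAdd[-1]^ n)))
      (subst (_≤₋ 𝟙) (sym val-π^n) (^-≤𝟙 n [ ℤ.-≤+ ]))
      (subst FiniteNet (sym val-π^n) (radiusNet eq N n)) N)
    where
    γ = ofAdd (ℤ.- (+ 1))
    val-π^n : val (π ^ᶠ n) ≡ γ ^ n
    val-π^n = trans (val-^ π n) (cong (_^ n) eq)

  residueNet : FiniteResidueField v → FiniteNet (ofAdd (ℤ.- (+ 1)))
  residueNet (n , I) = record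
    { size  = n
    ; point = I.to
    ; near  = λ x → I.from x , <𝟙⇒≤ (R.sym {I.to (I.from x)} {x} (I.strictlyInverseˡ x) .difference∈𝔪)
    }
    where module I = Inverse I

  -- Several points of a net may share a residue, so excluded middle first thins it to pairwise
  -- incongruent ones; each x then corresponds to the one kept point congruent to it.
  finiteResidueField : FiniteNet (ofAdd (ℤ.- (+ 1))) → FiniteResidueField v
  finiteResidueField N with distinct N.size N.point
    where
    module N = FiniteNet N
    distinct : ∀ n (f : Fin n → UnitBall v) → ∃[ m ] Σ (Fin m → UnitBall v) λ g →
      (∀ i j → g i R.≈ g j → i ≡ j) × (∀ i → ∃[ j ] f i R.≈ g j)
    distinct zero    f = 0 , (λ ()) , (λ ()) , λ ()
    distinct (suc n) f with distinct n (f ∘ suc)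
    ... | m , g , injective , covers with em {P = ∃[ j ] f zero R.≈ g j}
    ...   | yes f₀∈g = m , g , injective , λ where
            zero    → f₀∈g
            (suc i) → covers i
    ...   | no  f₀∉g = suc m , g′ , injective′ , λ where
            zero    → zero , R.refl {f zero}
            (suc i) → suc (proj₁ (covers i)) , proj₂ (covers i)
      where
      g′ : Fin (suc m) → UnitBall v
      g′ zero    = f zero
      g′ (suc i) = g i
      injective′ : ∀ i j → g′ i R.≈ g′ j → i ≡ j
      injective′ zero    zero    eq = refl
      injective′ zero    (suc j) eq = contradiction (j , eq) f₀∉g
      injective′ (suc i) zero    eq = contradiction (i , R.sym {g i} {f zero} eq) f₀∉g
      injective′ (suc i) (suc j) eq = cong suc (injective i j eq)
  ... | m , g , injective , covers = m , record
    { to        = g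
    ; from      = from
    ; to-cong   = λ { {i} refl → R.refl {g i} }
    ; from-cong = λ {x} {y} x≈y → injective _ _
        (R.trans {g (from x)} {x} {g (from y)} (g-from x)
          (R.trans {x} {y} x≈y (R.sym {g (from y)} {y} (g-from y))))
    ; inverse   = (λ { {x} refl → g-from x }) ,
        (λ {i} {x} x≈gi → injective _ _ (R.trans {g (from x)} {x} {g i} (g-from x) x≈gi))
    }
    where
    module N = FiniteNet N
    from : UnitBall v → Fin m
    from x = proj₁ (covers (proj₁ (N.near x)))
    g-from : ∀ x → g (from x) R.≈ x
    g-from x = let (i , p) = N.near x in
      R.trans {g (from x)} {N.point i} {x} (R.sym {N.point i} {g (from x)} (proj₂ (covers i)))
        (R.sym {x} {N.point i} (mk (≤-<₋-trans p [ ℤ.-<+ ])))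

  -- By the ultrametric inequality, bounds on consecutive steps bound all later differences. Hence
  -- the filter of sets containing a tail of `a` is Cauchy, and `Complete` applies to it.
  limit : Complete v → (a : ℕ → Carrier) →
    (∀ k → val (a (suc k) - a k) ≤₋ ofAdd (ℤ.- (+ k))) →
    ∃[ l ] ∀ k → val (l - a k) ≤₋ ofAdd (ℤ.- (+ k))
  limit complete a step = l , l-close
    where
    ε-antitone : ∀ {k m} → k ℕ.≤ m → ofAdd (ℤ.- (+ m)) ≤₋ ofAdd (ℤ.- (+ k))
    ε-antitone k≤m = [ ℤₚ.neg-mono-≤ (ℤ.+≤+ k≤m) ]

    close : ∀ {k m} → k ℕ.≤′ m → val (a m - a k) ≤₋ ofAdd (ℤ.- (+ k))
    close ℕ.≤′-refl = ≤₋-trans (≤₋-reflexive (val-sub-self ≈.refl)) (⊥₋≤ _)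
    close (ℕ.≤′-step {m} k≤m) = val-sub-trans (a m)
      (≤₋-trans (step m) (ε-antitone (ℕₚ.≤′⇒≤ k≤m))) (close k≤m)

    tails : Filter Carrier
    tails = record
      { member   = λ P → ∃[ k ] ∀ m → k ℕ.≤ m → P (a m)
      ; universe = 0 , λ _ _ → _
      ; upward   = λ P⊆Q (k , p) → k , λ m k≤m → P⊆Q (p m k≤m)
      ; ∩-closed = λ (k , p) (l , q) → k ℕ.⊔ l , λ m k⊔l≤m →
          p m (ℕₚ.m⊔n≤o⇒m≤o k l k⊔l≤m) , q m (ℕₚ.m⊔n≤o⇒n≤o k l k⊔l≤m)
      ; proper   = λ (k , p) → a k , p k ℕₚ.≤-refl
      }

    tails-cauchy : Cauchy v tails
    tails-cauchy n with ofAdd-archimedean n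
    ... | k , ε<n = (λ x → val (x - a k) ≤₋ ofAdd (ℤ.- (+ k)))
      , (k , λ m k≤m → close (ℕₚ.≤⇒≤′ k≤m))
      , λ p q → ≤-<₋-trans
          (val-sub-trans (a k) p (subst (_≤₋ _) (val-sub-sym _ _) q)) ε<n

    l = proj₁ (complete tails tails-cauchy)

    l-close : ∀ k → val (l - a k) ≤₋ ofAdd (ℤ.- (+ k))
    l-close k with proj₂ (complete tails tails-cauchy) (ℤ.- (+ k))
    -- At index `n ⊔ k` the sequence is already within the required distance of `l` and also past
    -- `k`, where it stays close to `a k`.
    ... | n , near = val-sub-trans (a (n ℕ.⊔ k))
      (subst (_≤₋ _) (val-sub-sym _ l) (<₋⇒≤₋ (near (n ℕ.⊔ k) (ℕₚ.m≤m⊔n n k))))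
      (close (ℕₚ.≤⇒≤′ (ℕₚ.m≤n⊔m n k)))

-- Values and linear combinations in an extension.

module FiniteExtension (em : ∀ {a} → ExcludedMiddle a)
  {c ℓ c′ ℓ′} {F : Field c ℓ} (v : Valuation F) (E : Extension F c′ ℓ′)
  (w : Valuation (Extension.extensionField E)) (w-extends-v : Extends E w v) where

  private
    K = Extension.extensionField E
    module F where
      open Field F public
      open Valuation v public
      open ValuedField em v public
  open Field K hiding (refl; sym; trans; zero)
  open Valuation w
  open ValuedField em w
  open RingHom (Extension.inclusion E)
    using (⟦_⟧; ⟦⟧-cong; +-homo; *-homo; -‿homo; 0#-homo; 1#-homo)
  open Algebra.Definitions.RawMonoid +-rawMonoid using (sum)
  open Algebra.Properties.AbelianGroup +-abelianGroup
    using (⁻¹-∙-comm; ⁻¹-anti-homo‿-; //-rightDividesˡ)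
  open Algebra.Properties.Ring ring using (-0#≈0#)
  open Algebra.Properties.CommutativeSemigroup +-commutativeSemigroup using (interchange)
  private
    module ≈ = Field K
    module R = CommutativeRing (residueField w)
    e = proj₁ w-extends-v
    1≤e = proj₁ (proj₂ w-extends-v)

  val-⟦⟧ : ∀ a → val ⟦ a ⟧ ≡ F.val a ^ e
  val-⟦⟧ = proj₂ (proj₂ w-extends-v)

  ⟦⟧-mono : ∀ {a b} → F.val a ≤₋ F.val b → val ⟦ a ⟧ ≤₋ val ⟦ b ⟧
  ⟦⟧-mono p = subst₂ _≤₋_ (sym (val-⟦⟧ _)) (sym (val-⟦⟧ _)) (^-monoˡ-≤ e p)

  -- Since `e` is at least 1, raising a value at most `𝟙` to the power `e` cannot increase it.
  ⟦⟧-≤ : ∀ {a} → F.val a ≤₋ 𝟙 → val ⟦ a ⟧ ≤₋ F.val a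
  ⟦⟧-≤ p = subst (_≤₋ _) (sym (val-⟦⟧ _)) (^-≤ 1≤e p)

  ⟦⟧-≤𝟙 : ∀ {a} → F.val a ≤₋ 𝟙 → val ⟦ a ⟧ ≤₋ 𝟙
  ⟦⟧-≤𝟙 p = ≤₋-trans (⟦⟧-≤ p) p

  ⟦⟧-<𝟙 : ∀ {a} → F.val a <₋ 𝟙 → val ⟦ a ⟧ <₋ 𝟙
  ⟦⟧-<𝟙 p = ≤-<₋-trans (⟦⟧-≤ (<₋⇒≤₋ p)) p

  ⟦⟧-≉0 : ∀ {a} → a F.≉ F.0# → ⟦ a ⟧ ≉ 0#
  ⟦⟧-≉0 {a} a≉0 ⟦a⟧≈0 with F.inverse a a≉0
  ... | b , ab≈1 = 1≉0 (≈.trans (≈.sym 1#-homo) (≈.trans (⟦⟧-cong (F.sym ab≈1))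
    (≈.trans (*-homo a b) (≈.trans (*-congʳ ⟦a⟧≈0) (zeroˡ _)))))

  ⟦⟧-sub : ∀ a b → ⟦ a F.- b ⟧ ≈ ⟦ a ⟧ - ⟦ b ⟧
  ⟦⟧-sub a b = ≈.trans (+-homo a (F.- b)) (+-congˡ (-‿homo b))

  sub-interchange : ∀ x y z t → (x + y) - (z + t) ≈ (x - z) + (y - t)
  sub-interchange x y z t = ≈.trans (+-congˡ (≈.sym (⁻¹-∙-comm z t))) (interchange x y (- z) (- t))

  combination : ∀ {n} → (Fin n → F.Carrier) → (Fin n → Carrier) → Carrier
  combination a b = sum (λ i → ⟦ a i ⟧ * b i)

  Spanned : ∀ {n} → (Fin n → Carrier) → Carrier → Set _
  Spanned {n} b x = Σ (Fin n → F.Carrier) λ a → x ≈ combination a b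

  combination-sub : ∀ {n} (a a′ : Fin n → F.Carrier) b →
    combination (λ i → a i F.- a′ i) b ≈ combination a b - combination a′ b
  combination-sub {zero}  a a′ b = ≈.sym (-‿inverseʳ 0#)
  combination-sub {suc n} a a′ b = ≈.trans
    (+-cong (≈.trans (*-congʳ (⟦⟧-sub (a zero) (a′ zero))) (sub-* _ _ _))
            (combination-sub (a ∘ suc) (a′ ∘ suc) (b ∘ suc)))
    (≈.sym (sub-interchange _ _ _ _))

  combination-* : ∀ {n} d (a : Fin n → F.Carrier) b →
    combination (λ i → d F.* a i) b ≈ ⟦ d ⟧ * combination a b
  combination-* {zero}  d a b = ≈.sym (zeroʳ ⟦ d ⟧)
  combination-* {suc n} d a b = ≈.trans
    (+-cong (≈.trans (*-congʳ (*-homo d (a zero))) (*-assoc _ _ _))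
            (combination-* d (a ∘ suc) (b ∘ suc)))
    (≈.sym (distribˡ _ _ _))

  combination-updateAt : ∀ {n} (a : Fin n → F.Carrier) b i d →
    combination (updateAt a i (F._+ d)) b ≈ combination a b + ⟦ d ⟧ * b i
  combination-updateAt {suc n} a b zero    d = begin
    ⟦ a zero F.+ d ⟧ * b zero + rest            ≈⟨ +-congʳ (*-congʳ (+-homo (a zero) d)) ⟩
    (⟦ a zero ⟧ + ⟦ d ⟧) * b zero + rest        ≈⟨ +-congʳ (distribʳ _ _ _) ⟩
    (⟦ a zero ⟧ * b zero + ⟦ d ⟧ * b zero) + rest ≈⟨ +-assoc _ _ _ ⟩
    ⟦ a zero ⟧ * b zero + (⟦ d ⟧ * b zero + rest) ≈⟨ +-congˡ (+-comm _ _) ⟩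
    ⟦ a zero ⟧ * b zero + (rest + ⟦ d ⟧ * b zero) ≈⟨ +-assoc _ _ _ ⟨
    combination a b + ⟦ d ⟧ * b zero            ∎
    where
    open SetoidReasoning setoid
    rest = combination (a ∘ suc) (b ∘ suc)
  combination-updateAt {suc n} a b (suc i) d = ≈.trans
    (+-congˡ (combination-updateAt (a ∘ suc) (b ∘ suc) i d)) (≈.sym (+-assoc _ _ _))

  val-updateAt : ∀ {n} (a : Fin n → F.Carrier) i d j →
    F.val (updateAt a i (F._+ d) j F.- a j) ≤₋ F.val d
  val-updateAt {suc n} a zero    d zero    = ≤₋-reflexive (F.val-cong
    (Algebra.Properties.AbelianGroup.xyx⁻¹≈y F.+-abelianGroup (a zero) d))
  val-updateAt {suc n} a zero    d (suc j) =
    ≤₋-trans (≤₋-reflexive (F.val-sub-self F.refl)) (⊥₋≤ _)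
  val-updateAt {suc n} a (suc i) d zero    =
    ≤₋-trans (≤₋-reflexive (F.val-sub-self F.refl)) (⊥₋≤ _)
  val-updateAt {suc n} a (suc i) d (suc j) = val-updateAt (a ∘ suc) i d j

  -- The vectors are integral, so the coefficients alone govern the size. The bound is the value of
  -- an element `d` of F because only such values can be transported by `⟦⟧-mono`.
  val-combination : ∀ {n d} (a : Fin n → F.Carrier) (b : Fin n → UnitBall w) →
    (∀ i → F.val (a i) ≤₋ F.val d) → val (combination a (elem ∘ b)) ≤₋ val ⟦ d ⟧
  val-combination {zero}  a b p = ≤₋-trans (≤₋-reflexive val-0) (⊥₋≤ _)
  val-combination {suc n} a b p = val-+-≤
    (≤₋-trans (≤₋-reflexive (val-* _ _)) (≤₋-trans (·-mono-≤ (⟦⟧-mono (p zero)) (elem≤ (b zero)))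
      (≤₋-reflexive (·-identityʳ _))))
    (val-combination (a ∘ suc) (b ∘ suc) (p ∘ suc))

  -- One step of Gaussian elimination: as `d` is the ratio of the leading coefficients, the
  -- coefficient of `b zero` cancels.
  eliminate : ∀ {n} (b : Fin (suc n) → Carrier) {x x′} →
    ((a , _) : Spanned b x) ((a′ , _) : Spanned b x′) →
    ∀ d → a zero F.≈ d F.* a′ zero → Spanned (b ∘ suc) (x - ⟦ d ⟧ * x′)
  eliminate b {x} {x′} (a , x≈) (a′ , x′≈) d a₀≈da′₀ = a″ ∘ suc , (begin
    x - ⟦ d ⟧ * x′
      ≈⟨ +-cong x≈ (-‿cong (≈.trans (*-congˡ x′≈) (≈.sym (combination-* d a′ b)))) ⟩
    combination a b - combination (λ i → d F.* a′ i) b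
      ≈⟨ combination-sub a (λ i → d F.* a′ i) b ⟨
    ⟦ a″ zero ⟧ * b zero + combination (a″ ∘ suc) (b ∘ suc)
      ≈⟨ +-congʳ (*-congʳ (≈.trans (⟦⟧-cong a″₀≈0) 0#-homo)) ⟩
    0# * b zero + combination (a″ ∘ suc) (b ∘ suc)
      ≈⟨ +-congʳ (zeroˡ _) ⟩
    0# + combination (a″ ∘ suc) (b ∘ suc)
      ≈⟨ +-identityˡ _ ⟩
    combination (a″ ∘ suc) (b ∘ suc) ∎)
    where
    open SetoidReasoning setoid
    a″ = λ i → a i F.- d F.* a′ i
    a″₀≈0 : a″ zero F.≈ F.0#
    a″₀≈0 = F.trans (F.+-congʳ a₀≈da′₀) (F.-‿inverseʳ _)

  -- Residues of the extension.

  scalar : ∀ a → F.val a ≤₋ 𝟙 → UnitBall w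
  scalar a p = ⟦ a ⟧ , ⟦⟧-≤𝟙 p

  -- Relative to a subset `P` of the unit ball, so that an induction on the spanning family can be
  -- run.
  record FiniteCover {q} (P : Pred (UnitBall w) q) : Set (c′ ⊔ q) where
    field
      size   : ℕ
      point  : Fin size → UnitBall w
      covers : ∀ x → P x → ∃[ i ] x R.≈ point i

  residue-≈ : ∀ x y → elem x ≈ elem y → x R.≈ y
  residue-≈ x y x≈y = mk (subst (_<₋ 𝟙) (sym (val-sub-self x≈y)) ⊥₋<[ + 0 ])

  scalar-cong : ∀ {a a′} p p′ → F.val (a F.- a′) <₋ 𝟙 → scalar a p R.≈ scalar a′ p′
  scalar-cong {a} {a′} _ _ q = mk (subst (_<₋ 𝟙) (val-cong (⟦⟧-sub a a′)) (⟦⟧-<𝟙 q))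

  scalar-≈0 : ∀ {a} p → F.val a <₋ 𝟙 → scalar a p R.≈ R.0#
  scalar-≈0 {a} p q = mk (subst (_<₋ 𝟙)
    (val-cong (≈.sym (≈.trans (+-congˡ -0#≈0#) (+-identityʳ ⟦ a ⟧)))) (⟦⟧-<𝟙 q))

  -- The image of `a` lies in the maximal ideal of K, so the subtracted term vanishes in the residue
  -- field.
  sub-scalar : ∀ {a} p → F.val a <₋ 𝟙 → ∀ x y → x R.≈ x R.- scalar a p R.* y
  sub-scalar {a} p q x y = R.sym (begin
    x R.- scalar a p R.* y  ≈⟨ R.+-congˡ (R.-‿cong (R.*-congʳ (scalar-≈0 p q))) ⟩
    x R.- R.0# R.* y        ≈⟨ residue-≈ _ _ (+-congˡ (≈.trans (-‿cong (zeroˡ _)) -0#≈0#)) ⟩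
    x R.+ R.0#              ≈⟨ R.+-identityʳ x ⟩
    x                       ∎)
    where open SetoidReasoning R.setoid

  module _ (N : F.FiniteNet (ofAdd (ℤ.- (+ 1)))) where
    private module N = F.FiniteNet N

    -- A residue x₀ of the span of b that is not one of the span of b ∘ suc
    -- generates all further residues: if x and x₀ have leading coefficients
    -- a and a₀, then v(a) ≤ v(a₀), as otherwise x₀ - (a₀/a) x would be a
    -- representative of x₀ in the smaller span.  Hence x - (a/a₀) x₀ is
    -- integral and lies in the smaller span.
    cover : ∀ {n} (b : Fin n → Carrier) → FiniteCover (Spanned b ∘ elem)
    cover {zero}  b = record
      { size   = 1
      ; point  = λ _ → R.0#
      ; covers = λ x (_ , x≈0) → zero , residue-≈ x R.0# x≈0
      }
    cover {suc n} b
      with em {P = Σ (UnitBall w) λ x → Spanned b (elem x) ×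
                 (∀ y → Spanned (b ∘ suc) (elem y) → ¬ x R.≈ y)}
    ... | no none = record
      { size   = C.size
      ; point  = C.point
      ; covers = covers
      }
      where
      module C = FiniteCover (cover (b ∘ suc))
      covers : ∀ x → Spanned b (elem x) → ∃[ i ] x R.≈ C.point i
      covers x x∈b with em {P = ∃[ y ] Spanned (b ∘ suc) (elem y) × x R.≈ y}
      ... | no  x∉ = contradiction (x , x∈b , λ y y∈ x≈y → x∉ (y , y∈ , x≈y)) none
      ... | yes (y , y∈ , x≈y) = let (i , y≈) = C.covers y y∈ in
        i , R.trans {x} {y} {C.point i} x≈y y≈
    ... | yes (x₀ , x₀∈b@(a₀ , _) , x₀-new) = record
      { size   = C.size ℕ.* N.size
      ; point  = λ ij → let (i , j) = remQuot N.size ij in point i j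
      ; covers = λ x x∈b → let (i , j , p) = covers x x∈b in
          combine i j , subst (λ (i , j) → x R.≈ point i j) (sym (remQuot-combine i j)) p
      }
      where
      module C = FiniteCover (cover (b ∘ suc))

      point : Fin C.size → Fin N.size → UnitBall w
      point i j = C.point i R.+ scalar (elem (N.point j)) (elem≤ (N.point j)) R.* x₀

      -- If the leading coefficient of `x₀` vanished, elimination with factor 0 would put `x₀`
      -- itself, up to equality, into the smaller span.
      a₀≉0 : a₀ zero F.≉ F.0#
      a₀≉0 a₀≈0 = x₀-new (x₀ R.- scalar F.0# 0≤1 R.* x₀)
        (eliminate b x₀∈b x₀∈b F.0# (F.trans a₀≈0 (F.sym (F.zeroˡ _))))
        (sub-scalar 0≤1 (subst (_<₋ 𝟙) (sym F.val-0) ⊥₋<[ + 0 ]) x₀ x₀)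
        where
        0≤1 = subst (_≤₋ 𝟙) (sym F.val-0) (⊥₋≤ 𝟙)

      covers : ∀ x → Spanned b (elem x) → ∃[ i ] ∃[ j ] x R.≈ point i j
      covers x x∈b@(a , _) with ≤₋-<₋-connex (F.val (a zero)) (F.val (a₀ zero))
      -- The reduced element x - d `x₀` is covered inductively, and `d` matters only through its
      -- residue, so a net point of F may replace it.
      ... | inj₁ a≤a₀ = i , j , (begin
        x
          ≈⟨ residue-≈ _ _ (≈.sym (//-rightDividesˡ _ (elem x))) ⟩
        (x R.- scalar d d≤1 R.* x₀) R.+ scalar d d≤1 R.* x₀
          ≈⟨ R.+-cong near-i (R.*-congʳ (scalar-cong d≤1 (elem≤ (N.point j))
               (≤-<₋-trans near-j [ ℤ.-<+ ]))) ⟩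
        point i j ∎)
        where
        open SetoidReasoning R.setoid
        d = proj₁ (F.quotient (a zero) a₀≉0)
        a≈da₀ = proj₂ (F.quotient (a zero) a₀≉0)
        d≤1 = F.val-quotient-≤ a₀≉0 a≈da₀ a≤a₀
        C-covers = C.covers (x R.- scalar d d≤1 R.* x₀) (eliminate b x∈b x₀∈b d a≈da₀)
        i = proj₁ C-covers
        near-i = proj₂ C-covers
        j = proj₁ (N.near (d , d≤1))
        near-j = proj₂ (N.near (d , d≤1))
      ... | inj₂ a₀<a = contradiction
        (sub-scalar (<₋⇒≤₋ d<1) d<1 x₀ x)
        (x₀-new _ (eliminate b x₀∈b x∈b d a₀≈da))
        where
        a≉0 = F.val>⇒≉0 a₀<a
        d = proj₁ (F.quotient (a₀ zero) a≉0)
        a₀≈da = proj₂ (F.quotient (a₀ zero) a≉0)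
        d<1 = F.val-quotient-< a≉0 a₀≈da a₀<a

    -- `b` spans all of K, so a cover of the residues of its span meets every residue.
    extensionNet : Finite E → FiniteNet (ofAdd (ℤ.- (+ 1)))
    extensionNet (_ , b , spans) = record
      { size  = C.size
      ; point = C.point
      ; near  = λ x → let (i , p) = C.covers x (spans (elem x)) in
          i , <𝟙⇒≤ (p .difference∈𝔪)
      }
      where module C = FiniteCover (cover b)

  -- Completeness of the extension.

  module _ (complete-v : Complete v)
    {ϖ} (val-ϖ : F.val ϖ ≡ ofAdd (ℤ.- (+ 1))) (N : FiniteNet (val ⟦ ϖ ⟧)) where
    private
      module N = FiniteNet N

      val-ϖ^ : ∀ k → F.val (ϖ F.^ᶠ k) ≡ ofAdd (ℤ.- (+ k))
      val-ϖ^ k = trans (F.val-^ ϖ k) (trans (cong (_^ k) val-ϖ) (ofAdd[-1]^ k))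

      -- Precision is measured by powers of `ϖ`, not of a uniformizer of K: the weights of the
      -- digits then lie in F and can be absorbed into coefficients.
      ρ : ℕ → ℤₘ₀
      ρ k = val ⟦ ϖ F.^ᶠ k ⟧

      ρ-≤ : ∀ k → ρ k ≤₋ ofAdd (ℤ.- (+ k))
      ρ-≤ k = subst (ρ k ≤₋_) (val-ϖ^ k)
        (⟦⟧-≤ (subst (_≤₋ 𝟙) (sym (val-ϖ^ k)) [ ℤₚ.neg-mono-≤ (ℤ.+≤+ ℕ.z≤n) ]))

      ρ-suc : ∀ k → ρ k · val ⟦ ϖ ⟧ ≡ ρ (suc k)
      ρ-suc k = trans (sym (val-* _ _))
        (val-cong (≈.trans (*-comm _ _) (≈.sym (*-homo ϖ (ϖ F.^ᶠ k)))))

      ρ-step : ∀ k → ρ (suc k) ≤₋ ρ k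
      ρ-step k = subst₂ _≤₋_ (ρ-suc k) (·-identityʳ (ρ k))
        (·-monoʳ-≤ (ρ k) (⟦⟧-≤𝟙 (subst (_≤₋ 𝟙) (sym val-ϖ) [ ℤ.-≤+ ])))

      L : (Fin N.size → F.Carrier) → Carrier
      L a = combination a (elem ∘ N.point)

      -- `t - L a` is ϖᵏ times an integral element. If the i-th net point is near that element,
      -- adding ϖᵏ to the i-th coefficient gains a factor `val ⟦ ϖ ⟧`.
      refine : ∀ k a t → val (t - L a) ≤₋ ρ k → ∃[ a′ ]
        (∀ i → F.val (a′ i F.- a i) ≤₋ ofAdd (ℤ.- (+ k))) × val (t - L a′) ≤₋ ρ (suc k)
      refine k a t p = updateAt a i (F._+ d)
        , (λ j → subst (F.val (updateAt a i (F._+ d) j F.- a j) ≤₋_) (val-ϖ^ k) (val-updateAt a i d j))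
        , subst₂ _≤₋_ (val-cong shifted) (ρ-suc k) (proj₂ approx)
        where
        d = ϖ F.^ᶠ k
        approx : ∃[ i ] val ((t - L a) - ⟦ d ⟧ * elem (N.point i)) ≤₋ ρ k · val ⟦ ϖ ⟧
        approx = N.near-scaled (⟦⟧-≉0 (F.val-ofAdd⇒≉0 (val-ϖ^ k))) p
        i = proj₁ approx
        shifted : (t - L a) - ⟦ d ⟧ * elem (N.point i) ≈ t - L (updateAt a i (F._+ d))
        shifted = ≈.trans (sub-sub t (L a) (⟦ d ⟧ * elem (N.point i)))
          (+-congˡ (-‿cong (≈.sym (combination-updateAt a (elem ∘ N.point) i d))))

    -- A Cauchy sequence is approximated by combinations of the points of N;
    -- going from precision ϖᵏ to ϖᵏ⁺¹ changes a single coefficient, by ϖᵏ.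
    -- Hence the coefficients converge in F.
    sequenceLimit : (x : ℕ → Carrier) → val (x 0) ≤₋ ρ 0 →
      (∀ k → val (x (suc k) - x k) ≤₋ ρ k) → ∃[ z ] ∀ k → val (x k - z) ≤₋ ρ k
    sequenceLimit x x₀≤ x-step = z , x-near-z
      where
      Approximation : ℕ → Set _
      Approximation k = ∃[ a ] val (x k - L a) ≤₋ ρ k

      next : ∀ k → ((a , _) : Approximation k) → ∃[ a′ ]
        (∀ i → F.val (a′ i F.- a i) ≤₋ ofAdd (ℤ.- (+ k))) × val (x (suc k) - L a′) ≤₋ ρ (suc k)
      next k (a , p) = refine k a (x (suc k)) (val-sub-trans (x k) (x-step k) p)

      approximation : ∀ k → Approximation k
      approximation zero    = (λ _ → F.0#) , val-+-≤ x₀≤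
        (≤₋-trans (≤₋-reflexive (val-neg w (L (λ _ → F.0#))))
          (val-combination (λ _ → F.0#) N.point (λ _ → ≤₋-trans (≤₋-reflexive F.val-0) (⊥₋≤ _))))
      approximation (suc k) = let (a′ , _ , p) = next k (approximation k) in a′ , p

      a : ℕ → Fin N.size → F.Carrier
      a k = proj₁ (approximation k)

      a-limit : ∀ i → ∃[ l ] ∀ k → F.val (l F.- a k i) ≤₋ ofAdd (ℤ.- (+ k))
      -- `a (suc k)` is by definition the vector produced by `next k`, whose step bound is the one
      -- that `limit` asks for.
      a-limit i = F.limit complete-v (λ k → a k i)
        (λ k → proj₁ (proj₂ (next k (approximation k))) i)

      l : Fin N.size → F.Carrier
      l i = proj₁ (a-limit i)

      z : Carrier
      z = L l

      z-near : ∀ k → val (z - L (a k)) ≤₋ ρ k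
      z-near k = subst (_≤₋ ρ k) (val-cong (combination-sub l (a k) (elem ∘ N.point)))
        (val-combination (λ i → l i F.- a k i) N.point
          (λ i → ≤₋-trans (proj₂ (a-limit i) k) (≤₋-reflexive (sym (val-ϖ^ k)))))

      x-near-z : ∀ k → val (x k - z) ≤₋ ρ k
      x-near-z k = val-sub-trans (L (a k)) (proj₂ (approximation k))
        (subst (_≤₋ ρ k) (val-sub-sym z (L (a k))) (z-near k))

    -- For each k a point is drawn from a filter member of diameter at most `ρ k`. As these members
    -- shrink, the limit of the sequence of points is a limit of the filter.
    extensionComplete : Complete w
    extensionComplete 𝓕 cauchy = x 0 + z , converges
      where
      open Filter 𝓕

      precise : ∀ k → ∃[ P ] member P × (∀ {x y} → P x → P y → val (x - y) ≤₋ ρ k)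
      precise k = let
          (n , ρ≡) = val-≉0 (⟦⟧-≉0 (F.val-ofAdd⇒≉0 (val-ϖ^ k)))
          (P , P∈𝓕 , p) = cauchy n
        in P , P∈𝓕 , λ {x} {y} x∈P y∈P →
          ≤₋-trans (<₋⇒≤₋ (p x∈P y∈P)) (≤₋-reflexive (sym ρ≡))

      P : ℕ → Pred Carrier _
      P k = proj₁ (precise k)
      P∈𝓕 : ∀ k → member (P k)
      P∈𝓕 k = proj₁ (proj₂ (precise k))
      small : ∀ k {x y} → P k x → P k y → val (x - y) ≤₋ ρ k
      small k = proj₂ (proj₂ (precise k))

      x : ℕ → Carrier
      x k = proj₁ (proper (P∈𝓕 k))
      x∈P : ∀ k → P k (x k)
      x∈P k = proj₂ (proper (P∈𝓕 k))

      x-step : ∀ k → val ((x (suc k) - x 0) - (x k - x 0)) ≤₋ ρ k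
      x-step k = subst (_≤₋ ρ k)
        (val-cong (≈.sym (≈.trans (+-congˡ (⁻¹-anti-homo‿- (x k) (x 0)))
          (sub-telescope (x (suc k)) (x 0) (x k)))))
        (val-sub-trans y (≤₋-trans (small (suc k) (x∈P (suc k)) y∈P′) (ρ-step k))
          (small k y∈P (x∈P k)))
        where
        -- The member chosen for k + 1 need not lie inside the one chosen for k; a common point,
        -- which exists because the filter is proper, links them.
        common = proper (∩-closed (P∈𝓕 (suc k)) (P∈𝓕 k))
        y = proj₁ common
        y∈P′ = proj₁ (proj₂ common)
        y∈P  = proj₂ (proj₂ common)

      x-limit : ∃[ z ] ∀ k → val ((x k - x 0) - z) ≤₋ ρ k
      -- Subtracting `x 0` makes the first term zero, hence integral as `sequenceLimit` requires;
      -- `converges` adds it back.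
      x-limit = sequenceLimit (λ k → x k - x 0)
        (≤₋-trans (≤₋-reflexive (val-sub-self ≈.refl)) (⊥₋≤ _)) x-step

      z = proj₁ x-limit

      converges : ConvergesTo w 𝓕 (x 0 + z)
      converges n = upward near (P∈𝓕 k)
        where
        k = proj₁ (ofAdd-archimedean n)
        near : ∀ {y} → P k y → val (y - (x 0 + z)) <₋ ofAdd n
        near y∈P = ≤-<₋-trans
          (val-sub-trans (x k) (small k y∈P (x∈P k))
            (subst (_≤₋ ρ k) (val-cong (sub-sub (x k) (x 0) z)) (proj₂ x-limit k)))
          (≤-<₋-trans (ρ-≤ k) (proj₂ (ofAdd-archimedean n)))

-- Local fields and uniformizers.

finiteExtension-isLocalField : (∀ {a} → ExcludedMiddle a) →
  ∀ {c ℓ c′ ℓ′} {F : Field c ℓ} {v : Valuation F} (K : Extension F c′ ℓ′) →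
  IsLocalField v → Finite K →
  (w : Valuation (Extension.extensionField K)) →
  Discrete w → Extends K w v → IsLocalField w
finiteExtension-isLocalField em {F = F} {v} K v-local finite w w-discrete ext = record
  { discrete           = w-discrete
  ; complete           = extensionComplete v-local.complete val-ϖ
      -- In K the value of `ϖ` is the e-th power of that of `π`, with e the exponent in `Extends`,
      -- so e digits in base `π` reach the radius `val ⟦ ϖ ⟧`.
      (subst W.FiniteNet (sym val-⟦ϖ⟧) (W.radiusNet val-π net (proj₁ ext)))
  ; finiteResidueField = W.finiteResidueField net
  }
  where
  open FiniteExtension em v K w ext
  module v-local = IsLocalField v-local
  module V = ValuedField em v
  module W = ValuedField em w
  ϖ = proj₁ (v-local.discrete (ofAdd (ℤ.- (+ 1))))
  π = proj₁ (w-discrete (ofAdd (ℤ.- (+ 1))))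
  val-ϖ : Valuation.val v ϖ ≡ ofAdd (ℤ.- (+ 1))
  val-ϖ = proj₂ (v-local.discrete (ofAdd (ℤ.- (+ 1)))) (Field.refl F)
  val-π : Valuation.val w π ≡ ofAdd (ℤ.- (+ 1))
  val-π = proj₂ (w-discrete (ofAdd (ℤ.- (+ 1)))) (Field.refl (Extension.extensionField K))
  net = extensionNet (V.residueNet v-local.finiteResidueField) finite
  val-⟦ϖ⟧ = trans (val-⟦⟧ ϖ) (cong (_^ proj₁ ext) val-ϖ)

-- Powers of `π` realise the negative exponents, and inverses of powers the others.
uniformizer⇒discrete : ∀ {c ℓ} {F : Field c ℓ} (v : Valuation F) →
  (∀ {a} → ExcludedMiddle a) →
  ∀ {π} → Valuation.val v π ≡ ofAdd (ℤ.- (+ 1)) → Discrete v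
uniformizer⇒discrete {F = F} v em {π} val-π = λ γ → let (x , eq) = preimage γ in
    x , λ z≈x → trans (val-cong z≈x) eq
  where
  open Field F using (Carrier; 0#; inverse)
  open Valuation v
  open ValuedField em v
  val-π^ : ∀ n → val (π ^ᶠ n) ≡ ofAdd (ℤ.- (+ n))
  val-π^ n = trans (val-^ π n) (trans (cong (_^ n) val-π) (ofAdd[-1]^ n))
  preimage : ∀ γ → ∃[ x ] val x ≡ γ
  preimage 𝟘                = 0# , val-0
  preimage (ofAdd -[1+ n ]) = π ^ᶠ suc n , val-π^ (suc n)
  preimage (ofAdd (+ n))    with inverse (π ^ᶠ n) (val-ofAdd⇒≉0 (val-π^ n))
  ... | y , π^n*y≈1 = y , ·-cancelʳ (ℤ.- (+ n)) (begin
    val y · ofAdd (ℤ.- (+ n)) ≡⟨ ·-comm (val y) _ ⟩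
    ofAdd (ℤ.- (+ n)) · val y ≡⟨ cong (_· val y) (val-π^ n) ⟨
    val (π ^ᶠ n) · val y      ≡⟨ val-* (π ^ᶠ n) y ⟨
    val (π ^ᶠ n * y)          ≡⟨ trans (val-cong π^n*y≈1) val-1 ⟩
    𝟙                         ≡⟨ cong just (ℤₚ.+-inverseʳ (+ n)) ⟨
    ofAdd (+ n) · ofAdd (ℤ.- (+ n)) ∎)
    where
    open ≡-Reasoning
    open Field F using (_*_)

-- The completed rational functions over a finite field of constants.

module FiniteConstants {c ℓ} (D : IntegralDomain c ℓ)
  (_≟0 : ∀ x → Dec (IntegralDomain._≈_ D x (IntegralDomain.0# D)))
  (invert : ∀ x → IntegralDomain._≉_ D x (IntegralDomain.0# D) →
    ∃[ y ] IntegralDomain._≈_ D (IntegralDomain._*_ D y x) (IntegralDomain.1# D))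
  {n} (constants : Fin n → IntegralDomain.Carrier D)
  (enumerates : ∀ x → ∃[ i ] IntegralDomain._≈_ D (constants i) x) where

  private module D = IntegralDomain D
  open Polynomial D.commutativeRing
  open RationalFunctions D _≟0
  open Fractions polynomialDomain renaming (_/_[_] to frac)
  private module Q = Field rationalFunctions

  valueₚ-<𝟙 : ∀ {a} → a D.≈ D.0# → ∀ f → valueₚ (a ∷ f) <₋ 𝟙
  valueₚ-<𝟙 a≈0 f = subst (_<₋ 𝟙) (sym (valueₚ-X a≈0 f))
    (≤-<₋-trans (·-monoʳ-≤ (ofAdd (ℤ.- (+ 1))) (valueₚ≤𝟙 f)) [ ℤ.-<+ ])

  -- `f` has no terms below the lowest degree of `g`, so a constant multiple of `g` can cancel its
  -- coefficient there. The recursion strips common factors X until `g` has a nonzero constant term.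
  cancelOrder : ∀ f g → ¬ g ≈ₚ [] → valueₚ f ≤₋ valueₚ g →
    ∃[ a ] valueₚ (f +ₚ scale a g) <₋ valueₚ g
  cancelOrder f       []      g≉0 _ = contradiction ≈ₚ-refl g≉0
  cancelOrder []      (b ∷ g) g≉0 _ = D.0# , subst₂ _<₋_
    (sym (valueₚ-zero (0-scale D.refl (b ∷ g)))) (sym (proj₂ (valueₚ≢𝟘 g≉0))) ⊥₋<[ _ ]
  cancelOrder (a ∷ f) (b ∷ g) g≉0 f≤g = split (a ≟0) (b ≟0)
    where
    split : Dec (a D.≈ D.0#) → Dec (b D.≈ D.0#) →
      ∃[ d ] valueₚ ((a ∷ f) +ₚ scale d (b ∷ g)) <₋ valueₚ (b ∷ g)
    split _ (no b≉0) = d , decreases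
      where
      b⁻¹ = proj₁ (invert b b≉0)
      b⁻¹b≈1 = proj₂ (invert b b≉0)
      d = D.- a D.* b⁻¹
      a+db≈0 : a D.+ d D.* b D.≈ D.0#
      a+db≈0 = D.trans (D.+-congˡ (D.trans (D.*-assoc (D.- a) b⁻¹ b)
        (D.trans (D.*-congˡ b⁻¹b≈1) (D.*-identityʳ (D.- a))))) (D.-‿inverseʳ a)
      decreases : valueₚ ((a ∷ f) +ₚ scale d (b ∷ g)) <₋ valueₚ (b ∷ g)
      decreases = subst (valueₚ ((a ∷ f) +ₚ scale d (b ∷ g)) <₋_)
        (sym (valueₚ-unit b≉0 g)) (valueₚ-<𝟙 a+db≈0 (f +ₚ scale d g))
    -- Impossible: the first polynomial would have value `𝟙` and the second a smaller one.
    split (no a≉0) (yes b≈0) = contradiction (≤-<₋-trans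
      (subst (_≤₋ valueₚ (b ∷ g)) (valueₚ-unit a≉0 f) f≤g) (valueₚ-<𝟙 b≈0 g)) <₋-irrefl
    split (yes a≈0) (yes b≈0) = d , subst₂ _<₋_
        (sym (valueₚ-X (D.trans (D.+-cong a≈0 (D.trans (D.*-congˡ b≈0) (D.zeroʳ d)))
          (D.+-identityʳ D.0#)) _))
        (sym (valueₚ-X b≈0 g))
        (·-monoʳ-< (ℤ.- (+ 1)) f+dg<g)
      where
      tail≤ : valueₚ f ≤₋ valueₚ g
      tail≤ = ·-cancelʳ-≤ (ℤ.- (+ 1)) (subst₂ _≤₋_
        (trans (valueₚ-X a≈0 f) (·-comm (ofAdd (ℤ.- (+ 1))) (valueₚ f)))
        (trans (valueₚ-X b≈0 g) (·-comm (ofAdd (ℤ.- (+ 1))) (valueₚ g))) f≤g)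
      ih = cancelOrder f g (λ g≈0 → g≉0 (∷≈[] b≈0 g≈0)) tail≤
      d = proj₁ ih
      f+dg<g = proj₂ ih

  fromPoly : Poly → Fraction
  fromPoly f = frac f 1ₚ (IntegralDomain.1≉0 polynomialDomain)

  valueₚ-1 : valueₚ 1ₚ ≡ 𝟙
  valueₚ-1 = valueₚ-unit D.1≉0 []

  X-adic-fromPoly : ∀ f → X-adic (fromPoly f) ≡ valueₚ f
  X-adic-fromPoly f = begin
    X-adic (fromPoly f)             ≡⟨ ·-identityʳ _ ⟨
    X-adic (fromPoly f) · 𝟙         ≡⟨ cong (X-adic (fromPoly f) ·_) valueₚ-1 ⟨
    X-adic (fromPoly f) · valueₚ 1ₚ ≡⟨ X-adic-den (fromPoly f) ⟩
    valueₚ f                        ∎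
    where open ≡-Reasoning

  X-adic-X : X-adic (fromPoly (shift 1ₚ)) ≡ ofAdd (ℤ.- (+ 1))
  X-adic-X = trans (X-adic-fromPoly (shift 1ₚ)) (trans (valueₚ-X D.refl 1ₚ)
    (cong (ofAdd (ℤ.- (+ 1)) ·_) valueₚ-1))

  constant : D.Carrier → Fraction
  constant a = fromPoly (a ∷ [])

  X-adic-constant : ∀ a → X-adic (constant a) ≤₋ 𝟙
  X-adic-constant a = subst (_≤₋ 𝟙) (sym (X-adic-fromPoly (a ∷ []))) (valueₚ≤𝟙 (a ∷ []))

  -- Write y = f / g. For some a the polynomial f + a g has smaller value than g, so y + a has value
  -- below `𝟙`, and the constant sought is the one representing -a.
  nearConstant : ∀ y → X-adic y ≤₋ 𝟙 → ∃[ i ] X-adic (y Q.- constant (constants i)) <₋ 𝟙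
  nearConstant y y≤1 = i , ·-cancelʳ-< {δ = 𝟙} m (subst₂ _<₋_
      (sym (trans (cong (X-adic d ·_) (sym m-eq)) (trans (X-adic-den d) (valueₚ-cong num-eq))))
      (trans den-eq′ (sym (·-identityˡ (ofAdd m))))
      (proj₂ cancel))
    where
    cancel : ∃[ a ] valueₚ (num y +ₚ scale a (den y)) <₋ valueₚ (den y)
    cancel = cancelOrder (num y) (den y) (den≉0 y) (subst₂ _≤₋_ (X-adic-den y)
      (·-identityˡ _) (·-mono-≤ y≤1 ≤₋-refl))
    a = proj₁ cancel
    i = proj₁ (enumerates (D.- a))
    d = y Q.- constant (constants i)
    m = proj₁ (valueₚ≢𝟘 (den≉0 d))
    m-eq : valueₚ (den d) ≡ ofAdd m
    m-eq = proj₂ (valueₚ≢𝟘 (den≉0 d))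
    module P = CommutativeRing polynomialRing
    -- The constant has denominator `1ₚ`, so `den d` is `den y *ₚ 1ₚ`.
    den-eq′ : valueₚ (den y) ≡ ofAdd m
    den-eq′ = trans (valueₚ-cong (P.sym (P.*-identityʳ (den y)))) m-eq
    -cᵢ≈a : D.- constants i D.≈ a
    -cᵢ≈a = D.trans (D.-‿cong (proj₂ (enumerates (D.- a))))
      (Algebra.Properties.Ring.-‿involutive D.ring a)
    num-eq : num d ≈ₚ num y +ₚ scale a (den y)
    num-eq = P.+-cong (P.*-identityʳ (num y))
      (P.trans (P.+-cong (scale-cong -cᵢ≈a ≈ₚ-refl) (∷≈[] D.refl ≈ₚ-refl)) (P.+-identityʳ _))

  -- By density an integral element is congruent to a rational function, which is then integral
  -- itself and so congruent to a constant. The image of X is a uniformizer.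
  completion-isLocalField : (∀ {a} → ExcludedMiddle a) →
    ∀ {c′ ℓ′} (F : Completion X-adicValuation c′ ℓ′) → IsLocalField (Completion.valuation F)
  completion-isLocalField em F = record
    { discrete = uniformizer⇒discrete valuation em
        (trans (extends (fromPoly (shift 1ₚ))) X-adic-X)
    ; complete = complete
    ; finiteResidueField = finiteResidueField (record
      { size  = n
      ; point = λ i → ⟦ constant (constants i) ⟧
          , subst (_≤₋ 𝟙) (sym (extends _)) (X-adic-constant (constants i))
      ; near  = near
      })
    }
    where
    open Completion F
    open Field completedField using (_-_; +-abelianGroup; +-congˡ)
      renaming (trans to ≈-trans)
    open Valuation valuation
    open ValuedField em valuation
    open RingHom embedding using (⟦_⟧; +-homo; -‿homo)
    near : ∀ (x : UnitBall valuation) →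
      ∃[ i ] val (elem x - ⟦ constant (constants i) ⟧) ≤₋ ofAdd (ℤ.- (+ 1))
    near x = i , val-sub-trans ⟦ y ⟧ (<𝟙⇒≤ x-y<1) (<𝟙⇒≤ (subst (_<₋ 𝟙)
        (trans (sym (extends _)) (val-cong (≈-trans (+-homo _ _) (+-congˡ (-‿homo _))))) y-cᵢ<1))
      where
      -- Precision `+ 0` means a distance strictly below `𝟙`, that is, congruence modulo `𝔪`.
      y = proj₁ (dense (elem x) (+ 0))
      x-y<1 = proj₂ (dense (elem x) (+ 0))
      y≤1 : X-adic y ≤₋ 𝟙
      y≤1 = subst (_≤₋ 𝟙) (trans (val-cong (//-rightDividesˡ _ _)) (extends y))
        (val-+-≤ (subst (_≤₋ 𝟙) (val-sub-sym _ _) (<₋⇒≤₋ x-y<1)) (elem≤ x))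
        where open Algebra.Properties.AbelianGroup +-abelianGroup using (//-rightDividesˡ)
      i = proj₁ (nearConstant y y≤1)
      y-cᵢ<1 = proj₂ (nearConstant y y≤1)

-- Representatives and inverses modulo p.

module PrimeField (p : ℕ) (prime : Prime p) where
  private
    module 𝔽 = IntegralDomain (𝔽ₚ p prime)
    instance
      p-nonZero : ℕ.NonZero p
      p-nonZero = prime⇒nonZero prime

  ≡⇒congruent : ∀ {a b} q → a ≡ b ℤ.+ q ℤ.* + p → a 𝔽.≈ b
  ≡⇒congruent {b = b} q refl = mk (divides q (solve 2
    (λ b qp → b :+ qp :- b := qp) refl b (q ℤ.* + p)))
    where open +-*-Solver

  remainder-congruent : ∀ a → + (a %ℕ p) 𝔽.≈ a
  remainder-congruent a = 𝔽.sym (≡⇒congruent (a /ℕ p) (a≡a%ℕn+[a/ℕn]*n a p))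

  representatives : Fin p → ℤ
  representatives i = + toℕ i

  representatives-complete : ∀ a → ∃[ i ] representatives i 𝔽.≈ a
  representatives-complete a = fromℕ< (n%ℕd<d a p) ,
    subst (λ r → + r 𝔽.≈ a) (sym (toℕ-fromℕ< (n%ℕd<d a p))) (remainder-congruent a)

  -- Bézout over the naturals gives 1 + y r = x p or 1 + x p = y r, so the inverse of r is -y or y
  -- accordingly.
  invert-remainder : ∀ r → Coprime p r → ∃[ y ] y ℤ.* + r 𝔽.≈ + 1
  invert-remainder r coprime with coprime-Bézout coprime
  ... | +- x y eq = ℤ.- (+ y) , ≡⇒congruent (ℤ.- (+ x)) (begin
    ℤ.- (+ y) ℤ.* + r
      ≡⟨ solve 2 (λ y r → :- y :* r := con (+ 1) :+ (:- (con (+ 1) :+ y :* r))) refl (+ y) (+ r) ⟩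
    + 1 ℤ.+ ℤ.- (+ 1 ℤ.+ + y ℤ.* + r)
      ≡⟨ cong (λ m → + 1 ℤ.+ ℤ.- m) (begin
           + 1 ℤ.+ + y ℤ.* + r ≡⟨ cong (λ m → + 1 ℤ.+ m) (ℤₚ.pos-* y r) ⟨
           + (1 ℕ.+ y ℕ.* r)   ≡⟨ cong +_ eq ⟩
           + (x ℕ.* p)         ≡⟨ ℤₚ.pos-* x p ⟩
           + x ℤ.* + p         ∎) ⟩
    + 1 ℤ.+ ℤ.- (+ x ℤ.* + p)
      ≡⟨ cong (λ m → + 1 ℤ.+ m) (ℤₚ.neg-distribˡ-* (+ x) (+ p)) ⟩
    + 1 ℤ.+ ℤ.- (+ x) ℤ.* + p ∎)
    where
    open ≡-Reasoning
    open +-*-Solver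
  ... | -+ x y eq = + y , ≡⇒congruent (+ x) (begin
    + y ℤ.* + r         ≡⟨ ℤₚ.pos-* y r ⟨
    + (y ℕ.* r)         ≡⟨ cong +_ eq ⟨
    + (1 ℕ.+ x ℕ.* p)   ≡⟨ cong (λ m → + 1 ℤ.+ m) (ℤₚ.pos-* x p) ⟩
    + 1 ℤ.+ + x ℤ.* + p ∎)
    where open ≡-Reasoning

  -- The remainder of `a` is nonzero and smaller than the prime p, hence coprime to it.
  invert : ∀ a → a 𝔽.≉ 𝔽.0# → ∃[ y ] y 𝔽.* a 𝔽.≈ 𝔽.1#
  invert a a≉0 = y , 𝔽.trans (𝔽.*-congˡ {y} (𝔽.sym (remainder-congruent a))) yr≈1
    where
    r = a %ℕ p
    r≢0 : r ≢ 0
    r≢0 r≡0 = a≉0 (𝔽.trans (𝔽.sym (remainder-congruent a)) (subst (λ m → + m 𝔽.≈ 𝔽.0#) (sym r≡0) 𝔽.refl))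
    inverse = invert-remainder r (prime⇒coprime prime {{ℕ.≢-nonZero r≢0}} (n%ℕd<d a p))
    y = proj₁ inverse
    yr≈1 = proj₂ inverse

mainTheorem9 : (∀ {a} → ExcludedMiddle a) →
    ∀ {c ℓ c′ ℓ′} (p : ℕ) (prime : Prime p)
    (F : Completion (𝔽ₚ⟨X⟩-valuation p prime) c ℓ)
    (K : Extension (Completion.completedField F) c′ ℓ′) →
    Finite K →
    Separable K →
    (w : Valuation (Extension.extensionField K)) →
    Discrete w →
    Extends K w (Completion.valuation F) →
    IsLocalField w
mainTheorem9 em p p-prime F K finite _ = finiteExtension-isLocalField em K
  (completion-isLocalField em F) finite
  where
  open PrimeField p p-prime
  -- The constants are the p classes of 0, ..., p - 1.
  open FiniteConstants (𝔽ₚ p p-prime) (𝔽ₚ-zero? p p-prime)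
    invert representatives representatives-complete
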